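{- (a) The isometric finite quotients of a universal embedding of a finite connected graph $G$ are exactly the finite-index sublattices $L\subseteq\mathbb{Z}^f$ of the free part whose folds pass the exact check, and the minimal host over them is found by enumerating Hermite-normal-form bases in increasing index, each verified by breadth-first search in the finite Cayley graph. (b) Restricting to diagonal $L$ can miss the optimum: for the diamond graph the universal embedding has $f=2$ with labels $(0,0),(1,0),(1,1),(2,1)$; every diagonal fold of index $6$ fails, yet the non-diagonal sublattice $L=\langle(3,0),(1,2)\rangle$ of index $6$ yields an isometric host of order $6$, namely the octahedron $\mathrm{Cay}(\mathbb{Z}_2\times\mathbb{Z}_3,\{\pm(0,1),\pm(1,1)\})$.
   Context: An oriented partition of $G$ is a partition $\{F_1,\dots,F_t\}$ of $E(G)$ with a chosen (forward) direction for each edge. Its signed cycle–class matrix $A\in\mathbb{Z}^{c\times t}$, $c=|E(G)|-|V(G)|+1$, with respect to a cycle basis $B_1,\dots,B_c$ of $G$ (cycles whose edge sets form a basis over $\mathbb{F}_2$ of the cycle space, each traversed in a fixed rotational sense), has $A[i,j]$ equal to the net signed number of crossings of $F_j$ by $B_i$ (forward $+1$, backward $-1$). The universal group is $\Gamma_{\mathrm{univ}}=\mathbb{Z}^t/\mathrm{rowlattice}(A)$, with $\mathrm{rowlattice}(A)$ the lattice generated by the rows of $A$; it is identified by the Smith normal form with $T\times\mathbb{Z}^f$, $T$ a finite torsion group and $\mathbb{Z}^f$ the free part. $g_j$ is the image of the $j$-th standard basis vector. The universal embedding is the labeling $\phi(v)=\sum_{e\in P(r,v)}\pm g_{\mathrm{class}(e)}$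 of $V(G)$ in $\Gamma_{\mathrm{univ}}$ along a path from a fixed root $r$ to $v$ (sign $+$ for forward, $-$ for backward traversal), where $\mathrm{class}(e)=j$ if $e\in F_j$, with connection set $\{\pm g_j: g_j\ne0\}$. An isometric finite quotient of the universal embedding is a finite abelian quotient group of $\Gamma_{\mathrm{univ}}$, with the induced labels and with connection set the nonzero images of the $\pm g_j$, that is injective and distance-preserving on the labels (Cayley distance between the labels of $u$ and $v$ equals $d_G(u,v)$ for all $u,v$). The fold by a finite-index sublattice $L\subseteq\mathbb{Z}^f$ is the finite quotient group $\Gamma_L=\Gamma_{\mathrm{univ}}/L$ with the induced labels and connection set; the host is the resulting finite Cayley graph and its order is $|\Gamma_L|$. The exact check compares all $\binom{n}{2}$ distances, $n=|V(G)|$, in $G$ with the distances between labels found by breadth-first search in the finite Cayley graph; a fold fails if it does not pass this check. $L$ is diagonal if $L=N_1\mathbb{Z}\times\cdots\times N_f\mathbb{Z}$. Index means index in $\mathbb{Z}^f$. $\mathrm{Cay}(\Gamma,S)$ is the graph on $\Gamma$ with edges $\{h,h+s\}$, $s\in S$; $d_G$ is the shortest-path metric of $G$. The diamond is $K_4$ minus an edge, on vertices $0,1,2,3$ with single non-edge $\{0,3\}$; the labels in (b) are those of $0,1,2,3$ in this order, and arise from the oriented partition $\{0\to1,\;2\to3\}$, $\{0\to2,\;1\to3\}$, $\{1\to2\}$ with $\Gamma_{\mathrm{univ}}\cong\mathbb{Z}^2$ and class generators $(1,0)$, $(1,1)$, $(0,1)$ respectively.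
   Formalization: In (a), including the minimal host, only quotients whose kernel lies in the free part are considered (automatic if T is trivial); otherwise (a) fails: the prism C_5×K_2 has universal group Z_5×Z, and its quotient by <(1,5)> is isometric but not a fold. -}

module Defs where

open import Level using (0ℓ)
open import Algebra.Bundles using (AbelianGroup; CommutativeRing)
import Algebra.Construct.DirectProduct as DirectProduct
import Algebra.Construct.Pointwise as Pointwise
import Algebra.Properties.AbelianGroup as AbelianGroupProperties
import Algebra.Properties.CommutativeSemigroup as CSProperties
import Algebra.Properties.Semiring.Sum as SemiringSum
open import Algebra.Morphism.Structures using (module GroupMorphisms)
open import Data.Bool using (Bool; true; false; _∧_; _∨_; _xor_; if_then_else_)
import Data.Bool.Properties as Bool
open import Data.Fin as Fin using (Fin; zero; suc; #_; fromℕ<; toℕ; combine; remQuot)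
import Data.Fin.Properties as Fin
open import Data.Integer as ℤ using (ℤ; +_; -[1+_]; 0ℤ; 1ℤ; ∣_∣; _/ℕ_; _%ℕ_)
import Data.Integer.Divisibility as ℤ
import Data.Integer.Divisibility.Signed as Signed
import Data.Integer.DivMod as ℤ
import Data.Integer.Properties as ℤ
import Data.Integer.Solver as ℤSolver
open import Data.List as List using (List; []; _∷_; _++_)
import Data.List.Membership.DecSetoid as DecMembership
open import Data.List.Relation.Unary.Unique.Propositional using (Unique)
open import Data.Maybe using (Maybe; just; nothing)
import Data.Maybe.Properties as Maybe
open import Data.Nat as ℕ using (ℕ; zero; suc; _∸_)
import Data.Nat.DivMod as ℕ
import Data.Nat.Divisibility as ℕ
import Data.Nat.Properties as ℕ
open import Data.Product using (Σ; ∃; _×_; _,_; proj₁; proj₂)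
open import Data.Sum using (_⊎_; inj₁; inj₂)
open import Data.Vec.Functional as Vector using (Vector)
open import Function using (_∘_; case_of_)
open import Function.Bundles using (Inverse; _⇔_)
open import Function.Definitions using (Surjective)
open import Relation.Binary using (Rel; Setoid; DecSetoid; Decidable)
open import Relation.Binary.PropositionalEquality as ≡
  using (_≡_; _≢_; _≗_; refl; sym; trans; cong; cong₂; subst)
open import Relation.Nullary using (¬_; Dec; yes; no; ¬?; does)
import Relation.Nullary.Decidable as Dec
open import Relation.Nullary.Decidable using (_×-dec_; _→-dec_)

open AbelianGroup using () renaming (Carrier to ∣_∣ᴳ)

record UGraph : Set₁ where
  field
    vertices : Setoid 0ℓ 0ℓ
    Adj      : Rel (Setoid.Carrier vertices) 0ℓ

  open Setoid vertices public using () renaming (Carrier to V; _≈_ to _≈ⱽ_)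

  data WalkOfLength : ℕ → V → V → Set where
    stop : ∀ {u v} → u ≈ⱽ v → WalkOfLength 0 u v
    step : ∀ {k u v w} → Adj u v → WalkOfLength k v w → WalkOfLength (suc k) u w

  IsDistance : V → V → ℕ → Set
  IsDistance u v k =
    WalkOfLength k u v × (∀ {k′} → WalkOfLength k′ u v → k ℕ.≤ k′)

record GraphIso (G H : UGraph) : Set where
  private
    module G = UGraph G
    module H = UGraph H
  field
    bijection : Inverse G.vertices H.vertices
    adj⇔      : ∀ u v → G.Adj u v ⇔ H.Adj (Inverse.to bijection u) (Inverse.to bijection v)

-- Breadth-first search by layers.  The fuel bounds the number of layers; the
-- number of vertices always suffices.
module BFS (S : DecSetoid 0ℓ 0ℓ) (neighbours : DecSetoid.Carrier S → List (DecSetoid.Carrier S)) where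
  open DecSetoid S using (Carrier; _≟_)
  open DecMembership S using (_∈?_)

  layers : (fuel depth : ℕ) (visited frontier : List Carrier) → Carrier → Maybe ℕ
  layers zero       depth visited frontier target = nothing
  layers (suc fuel) depth visited frontier target =
    if does (target ∈? frontier) then just depth
    else layers fuel (suc depth) visited′ frontier′ target
    where
    visited′  = frontier ++ visited
    frontier′ = List.deduplicate _≟_
      (List.filter (λ v → ¬? (v ∈? visited′)) (List.concatMap neighbours frontier))

  bfs : (fuel : ℕ) → Carrier → Carrier → Maybe ℕ
  bfs fuel source target = layers fuel 0 [] (source ∷ []) target

-- Finite simple graphs.  Each edge is stored with an arbitrary reference order
-- of its two ends, unrelated to the directions of an oriented partition.
record Graph : Set where
  field
    n m      : ℕ
    end₁     : Fin m → Fin n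
    end₂     : Fin m → Fin n
    loopless : ∀ e → end₁ e ≢ end₂ e
    simple   : ∀ e e′ →
      (end₁ e ≡ end₁ e′ × end₂ e ≡ end₂ e′) ⊎ (end₁ e ≡ end₂ e′ × end₂ e ≡ end₁ e′) →
      e ≡ e′

  -- An edge with a direction of traversal; true is the reference order.
  Dart : Set
  Dart = Fin m × Bool

  source target : Dart → Fin n
  source (e , b) = if b then end₁ e else end₂ e
  target (e , b) = if b then end₂ e else end₁ e

  data Walk : Fin n → Fin n → Set where
    []   : ∀ {u} → Walk u u
    step : ∀ {u w} (d : Dart) → source d ≡ u → Walk (target d) w → Walk u w

  darts : ∀ {u v} → Walk u v → List Dart
  darts []           = []
  darts (step d _ w) = d ∷ darts w

  record Path (u v : Fin n) : Set where
    field
      walk   : Walk u v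
      unique : Unique (List.map source (darts walk) List.∷ʳ v)

  record Cycle : Set where
    field
      {base}   : Fin n
      walk     : Walk base base
      unique   : Unique (List.map source (darts walk))
      length≥3 : 3 ℕ.≤ List.length (darts walk)

  Connected : Set
  Connected = ∀ u v → Walk u v

  ugraph : UGraph
  ugraph = record
    { vertices = ≡.setoid (Fin n)
    ; Adj      = λ u v → ∃ λ d → source d ≡ u × target d ≡ v
    }

  neighbours : Fin n → List (Fin n)
  neighbours u = List.concatMap around (List.allFin m)
    where
    around : Fin m → List (Fin n)
    around e = (if does (end₁ e Fin.≟ u) then end₂ e ∷ [] else [])
            ++ (if does (end₂ e Fin.≟ u) then end₁ e ∷ [] else [])

  bfsᴳ : Fin n → Fin n → Maybe ℕ
  bfsᴳ = BFS.bfs (Fin.≡-decSetoid n) neighbours n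

  open SemiringSum (CommutativeRing.semiring Bool.xor-∧-commutativeRing) public
    using () renaming (sum to ⨁)

  EdgeSet : Set
  EdgeSet = Fin m → Bool

  edgeSet : Cycle → EdgeSet
  edgeSet C e = List.foldr (λ d b → does (proj₁ d Fin.≟ e) ∨ b) false (darts (Cycle.walk C))

  incident : Fin m → Fin n → Bool
  incident e v = does (end₁ e Fin.≟ v) ∨ does (end₂ e Fin.≟ v)

  InCycleSpace : EdgeSet → Set
  InCycleSpace X = ∀ v → ⨁ (λ e → X e ∧ incident e v) ≡ false

  combination : ∀ {k} → Vector Bool k → Vector EdgeSet k → EdgeSet
  combination a X e = ⨁ (λ i → a i ∧ X i e)

  cyclomatic : ℕ
  cyclomatic = (m ℕ.+ 1) ∸ n

  record CycleBasis : Set where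
    field
      cycles      : Vector Cycle cyclomatic
      independent : ∀ a → (∀ e → combination a (edgeSet ∘ cycles) e ≡ false) →
                    ∀ i → a i ≡ false
      spanning    : ∀ X → InCycleSpace X → ∃ λ a → combination a (edgeSet ∘ cycles) ≗ X

record OrientedPartition (G : Graph) : Set where
  open Graph G
  field
    t       : ℕ
    class   : Fin m → Fin t
    onto    : ∀ j → ∃ λ e → class e ≡ j
    -- true when the forward direction is end₁ → end₂
    forward : Fin m → Bool

  isForward : Dart → Bool
  isForward (e , b) = does (forward e Bool.≟ b)

ℤ^ : ℕ → AbelianGroup 0ℓ 0ℓ
ℤ^ k = record { isAbelianGroup = Pointwise.isAbelianGroup (Fin k) ℤ.+-0-isAbelianGroup }

record Subgroup (G : AbelianGroup 0ℓ 0ℓ) : Set₁ where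
  open AbelianGroup G
  field
    Member    : Carrier → Set
    resp      : ∀ {x y} → x ≈ y → Member x → Member y
    ε-closed  : Member ε
    ∙-closed  : ∀ {x y} → Member x → Member y → Member (x ∙ y)
    ⁻¹-closed : ∀ {x} → Member x → Member (x ⁻¹)

quotient : (G : AbelianGroup 0ℓ 0ℓ) → Subgroup G → AbelianGroup 0ℓ 0ℓ
quotient G N = record
  { Carrier = Carrier
  ; _≈_     = _∼_
  ; _∙_     = _∙_
  ; ε       = ε
  ; _⁻¹     = _⁻¹
  ; isAbelianGroup = record
    { isGroup = record
      { isMonoid = record
        { isSemigroup = record
          { isMagma = record
            { isEquivalence = record
              { refl  = ≈⇒∼ G.refl
              ; sym   = λ {x} {y} p → resp (⁻¹-anti-homo‿- x y) (⁻¹-closed p)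
              ; trans = λ {x} {y} {z} p q → resp (telescope x y z) (∙-closed p q)
              }
            ; ∙-cong = λ {x} {y} {u} {v} p q → resp (exchange x y u v) (∙-closed p q)
            }
          ; assoc = λ x y z → ≈⇒∼ (assoc x y z)
          }
        ; identity = (λ x → ≈⇒∼ (identityˡ x)) , (λ x → ≈⇒∼ (identityʳ x))
        }
      ; inverse = (λ x → ≈⇒∼ (inverseˡ x)) , (λ x → ≈⇒∼ (inverseʳ x))
      ; ⁻¹-cong = λ {x} {y} p → resp (G.sym (⁻¹-∙-comm x (y ⁻¹))) (⁻¹-closed p)
      }
    ; comm = λ x y → ≈⇒∼ (comm x y)
    }
  }
  where
  module G = AbelianGroup G
  open AbelianGroup G hiding (refl; sym; trans)
  open AbelianGroupProperties G
  open CSProperties commutativeSemigroup using (interchange)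
  open Subgroup N
  open import Relation.Binary.Reasoning.Setoid setoid

  _∼_ : Rel Carrier 0ℓ
  x ∼ y = Member (x ∙ y ⁻¹)

  ≈⇒∼ : ∀ {x y} → x ≈ y → x ∼ y
  ≈⇒∼ x≈y = resp (G.sym (x≈y⇒x∙y⁻¹≈ε x≈y)) ε-closed

  telescope : ∀ x y z → (x ∙ y ⁻¹) ∙ (y ∙ z ⁻¹) ≈ x ∙ z ⁻¹
  telescope x y z = begin
    (x ∙ y ⁻¹) ∙ (y ∙ z ⁻¹)  ≈⟨ assoc x (y ⁻¹) (y ∙ z ⁻¹) ⟩
    x ∙ (y ⁻¹ ∙ (y ∙ z ⁻¹))  ≈⟨ ∙-congˡ (assoc (y ⁻¹) y (z ⁻¹)) ⟨
    x ∙ ((y ⁻¹ ∙ y) ∙ z ⁻¹)  ≈⟨ ∙-congˡ (∙-congʳ (inverseˡ y)) ⟩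
    x ∙ (ε ∙ z ⁻¹)           ≈⟨ ∙-congˡ (identityˡ (z ⁻¹)) ⟩
    x ∙ z ⁻¹                 ∎

  exchange : ∀ x y u v → (x ∙ y ⁻¹) ∙ (u ∙ v ⁻¹) ≈ (x ∙ u) ∙ (y ∙ v) ⁻¹
  exchange x y u v = begin
    (x ∙ y ⁻¹) ∙ (u ∙ v ⁻¹)  ≈⟨ interchange x (y ⁻¹) u (v ⁻¹) ⟩
    (x ∙ u) ∙ (y ⁻¹ ∙ v ⁻¹)  ≈⟨ ∙-congˡ (⁻¹-∙-comm y v) ⟩
    (x ∙ u) ∙ (y ∙ v) ⁻¹     ∎

open Subgroup using (Member)

record Finite (S : Setoid 0ℓ 0ℓ) : Set where
  field
    order       : ℕ
    enumeration : Inverse S (≡.setoid (Fin order))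

  open Inverse enumeration public

  decidable : Decidable (Setoid._≈_ S)
  decidable x y = Dec.map′ injective to-cong (to x Fin.≟ to y)
    where
    injective : to x ≡ to y → Setoid._≈_ S x y
    injective eq = Setoid.trans S (Setoid.sym S (inverseʳ refl)) (inverseʳ eq)

  decSetoid : DecSetoid 0ℓ 0ℓ
  decSetoid = record
    { isDecEquivalence = record { isEquivalence = Setoid.isEquivalence S ; _≟_ = decidable } }

±_ : ∀ {G : AbelianGroup 0ℓ 0ℓ} {k} → Vector ∣ G ∣ᴳ k → ∣ G ∣ᴳ → Set
±_ {G} g s = ∃ λ j → s ≈ g j ⊎ s ≈ g j ⁻¹
  where open AbelianGroup G

Cay : (G : AbelianGroup 0ℓ 0ℓ) → (∣ G ∣ᴳ → Set) → UGraph
Cay G S = record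
  { vertices = setoid
  ; Adj      = λ h k → ∃ λ s → S s × k ≈ h ∙ s
  }
  where open AbelianGroup G

-- Isomorphism of Cayley graphs induced by an isomorphism of groups.
record CayIso (G : AbelianGroup 0ℓ 0ℓ) (S : ∣ G ∣ᴳ → Set)
              (H : AbelianGroup 0ℓ 0ℓ) (T : ∣ H ∣ᴳ → Set) : Set where
  open GroupMorphisms (AbelianGroup.rawGroup G) (AbelianGroup.rawGroup H)
  field
    ⟦_⟧           : ∣ G ∣ᴳ → ∣ H ∣ᴳ
    isIsomorphism : IsGroupIsomorphism ⟦_⟧
    connection⇔   : ∀ s → S s ⇔ T ⟦ s ⟧

open SemiringSum ℤ.+-*-semiring public
  using () renaming (sum to Σℤ)

private
  module ∑ = SemiringSum ℤ.+-*-semiring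
  module ℤ-Ring = AbelianGroupProperties ℤ.+-0-abelianGroup

Matrix : ℕ → ℕ → Set
Matrix c t = Fin c → Fin t → ℤ

rowLattice : ∀ {c t} → Matrix c t → Subgroup (ℤ^ t)
rowLattice {c} {t} A = record
  { Member    = InSpan
  ; resp      = λ { x≈y (a , p) → a , λ j → trans (sym (x≈y j)) (p j) }
  ; ε-closed  = (λ _ → 0ℤ) , λ j → sym (∑.sum-replicate-zero c)
  ; ∙-closed  = λ { (a , p) (b , q) → (λ i → a i ℤ.+ b i) , λ j → trans
      (cong₂ ℤ._+_ (p j) (q j))
      (trans (sym (∑.∑-distrib-+ (λ i → a i ℤ.* A i j) (λ i → b i ℤ.* A i j)))
             (∑.sum-cong-≗ (λ i → sym (ℤ.*-distribʳ-+ (A i j) (a i) (b i))))) }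
  ; ⁻¹-closed = λ { (a , p) → (λ i → ℤ.- a i) , λ j → trans
      (cong ℤ.-_ (p j))
      (trans (neg-sum (λ i → a i ℤ.* A i j))
             (∑.sum-cong-≗ (λ i → ℤ.neg-distribˡ-* (a i) (A i j)))) }
  }
  where
  InSpan : Vector ℤ t → Set
  InSpan x = ∃ λ (a : Vector ℤ c) → ∀ j → x j ≡ Σℤ (λ i → a i ℤ.* A i j)

  neg-sum : ∀ {k} (v : Vector ℤ k) → ℤ.- Σℤ v ≡ Σℤ (ℤ.-_ ∘ v)
  neg-sum {zero}  v = refl
  neg-sum {suc k} v = trans (ℤ.neg-distrib-+ (v zero) (Σℤ (v ∘ suc)))
                            (cong (ℤ._+_ (ℤ.- v zero)) (neg-sum (v ∘ suc)))

_≐_ : ∀ {G} → Subgroup G → Subgroup G → Set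
L ≐ M = ∀ x → Member L x ⇔ Member M x

record FiniteIndexSublattice (f : ℕ) : Set₁ where
  field
    lattice  : Subgroup (ℤ^ f)
    finite   : Finite (AbelianGroup.setoid (quotient (ℤ^ f) lattice))

  index : ℕ
  index = Finite.order finite

IsDiagonal : ∀ {f} → FiniteIndexSublattice f → Set
IsDiagonal {f} L = ∃ λ (N : Vector ℕ f) → ∀ x →
  Member (FiniteIndexSublattice.lattice L) x ⇔ (∀ i → (+ N i) ℤ.∣ x i)

diagonalProduct : ∀ {f} → Matrix f f → ℕ
diagonalProduct M = Vector.foldr ℕ._*_ 1 (λ i → ∣ M i i ∣)

-- Row-style Hermite normal form of a nonsingular square matrix.
record IsHNF {f} (M : Matrix f f) : Set where
  constructor mkHNF
  field
    triangular : ∀ i j → j Fin.< i → M i j ≡ 0ℤ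
    positive   : ∀ i → 0ℤ ℤ.< M i i
    reduced    : ∀ i j → i Fin.< j → 0ℤ ℤ.≤ M i j × M i j ℤ.< M j j

isHNF? : ∀ {f} (M : Matrix f f) → Dec (IsHNF M)
isHNF? M = Dec.map′ (λ { (t , p , r) → mkHNF t p r }) (λ { (mkHNF t p r) → t , p , r })
  (Fin.all? (λ i → Fin.all? λ j → (j Fin.<? i) →-dec (M i j ℤ.≟ 0ℤ))
  ×-dec Fin.all? (λ i → 0ℤ ℤ.<? M i i)
  ×-dec Fin.all? (λ i → Fin.all? λ j →
          (i Fin.<? j) →-dec ((0ℤ ℤ.≤? M i j) ×-dec (M i j ℤ.<? M j j))))

HNFBasis : ℕ → Set
HNFBasis f = Σ (Matrix f f) IsHNF

vectors : ∀ {A : Set} → List A → ∀ k → List (Vector A k)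
vectors xs zero    = Vector.[] ∷ []
vectors xs (suc k) = List.cartesianProductWith Vector._∷_ xs (vectors xs k)

-- The Hermite-normal-form bases of index N: their entries are nonnegative and
-- at most N, since each is at most a diagonal entry and these multiply to N.
hnfBases : ∀ f (N : ℕ) → List (HNFBasis f)
hnfBases f N = List.mapMaybe check (vectors (vectors entries f) f)
  where
  entries : List ℤ
  entries = List.map +_ (List.upTo (suc N))

  check : Matrix f f → Maybe (HNFBasis f)
  check M = case (isHNF? M ×-dec (diagonalProduct M ℕ.≟ N)) of λ where
    (yes (h , _)) → just (M , h)
    (no _)        → nothing

-- The lattice spanned by a triangular matrix with positive diagonal has index
-- the product of the diagonal: successive division by the diagonal entries
-- gives mixed-radix residues.
module Residues where

  minor : ∀ {f} → Matrix (suc f) (suc f) → Matrix f f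
  minor M i j = M (suc i) (suc j)

  record Triangular {f} (M : Matrix f f) : Set where
    field
      below    : ∀ i j → j Fin.< i → M i j ≡ 0ℤ
      positive : ∀ i → 0ℤ ℤ.< M i i

  minor-triangular : ∀ {f} {M : Matrix (suc f) (suc f)} → Triangular M → Triangular (minor M)
  minor-triangular T = record
    { below    = λ i j j<i → Triangular.below T (suc i) (suc j) (ℕ.s≤s j<i)
    ; positive = λ i → Triangular.positive T (suc i)
    }

  positive⇒nonZero : ∀ {z} → 0ℤ ℤ.< z → ℕ.NonZero ∣ z ∣
  positive⇒nonZero (ℤ.+<+ 0<n) = ℕ.>-nonZero 0<n

  positive⇒abs : ∀ {z} → 0ℤ ℤ.< z → + ∣ z ∣ ≡ z
  positive⇒abs (ℤ.+<+ _) = refl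

  remainder-unique : ∀ d (r s : ℕ) (k : ℤ) → r ℕ.< d → s ℕ.< d →
                     + r ≡ + s ℤ.+ k ℤ.* + d → r ≡ s
  remainder-unique d r s (+ k) r<d s<d eq =
    trans (sym (ℕ.m<n⇒m%n≡m {{nz}} r<d))
      (trans (cong (λ x → ℕ._%_ x d {{nz}}) (ℤ.+-injective (trans eq
               (cong (ℤ._+_ (+ s)) (sym (ℤ.pos-* k d))))))
        (trans (ℕ.[m+kn]%n≡m%n s k d {{nz}}) (ℕ.m<n⇒m%n≡m {{nz}} s<d)))
    where
    nz : ℕ.NonZero d
    nz = ℕ.>-nonZero (ℕ.≤-<-trans ℕ.z≤n r<d)
  remainder-unique d r s k@(-[1+ _ ]) r<d s<d eq =
    sym (remainder-unique d s r (ℤ.- k) s<d r<d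
      (trans (solve 3 (λ s k d → s := (s :+ k :* d) :+ (:- k) :* d) refl (+ s) k (+ d))
             (cong (λ z → z ℤ.+ (ℤ.- k) ℤ.* + d) (sym eq))))
    where open ℤSolver.+-*-Solver

  toResidue : ∀ {f} (M : Matrix f f) → Triangular M → Vector ℤ f → Fin (diagonalProduct M)
  toResidue {zero}  M T x = zero
  toResidue {suc f} M T x =
    combine (fromℕ< (ℤ.n%ℕd<d (x zero) d))
            (toResidue (minor M) (minor-triangular T)
                       (λ j → x (suc j) ℤ.- (x zero /ℕ d) ℤ.* M zero (suc j)))
    where
    d = ∣ M zero zero ∣
    instance
      d≢0 : ℕ.NonZero d
      d≢0 = positive⇒nonZero (Triangular.positive T zero)

  fromResidue : ∀ {f} (M : Matrix f f) → Fin (diagonalProduct M) → Vector ℤ f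
  fromResidue {zero}  M k = Vector.[]
  fromResidue {suc f} M k = assemble (remQuot (diagonalProduct (minor M)) k)
    where
    assemble : Fin ∣ M zero zero ∣ × Fin (diagonalProduct (minor M)) → Vector ℤ (suc f)
    assemble (r , k′) = (+ toℕ r) Vector.∷ fromResidue (minor M) k′

  module _ {f} (M : Matrix (suc f) (suc f)) (T : Triangular M) where
    private
      d = ∣ M zero zero ∣

      column₀ : ∀ (a : Vector ℤ (suc f)) → Σℤ (λ i → a i ℤ.* M i zero) ≡ a zero ℤ.* M zero zero
      column₀ a = trans
        (cong (ℤ._+_ (a zero ℤ.* M zero zero))
          (trans (∑.sum-cong-≗ (λ i → trans
                   (cong (ℤ._*_ (a (suc i))) (Triangular.below T (suc i) zero (ℕ.s≤s ℕ.z≤n)))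
                   (ℤ.*-zeroʳ (a (suc i)))))
                 (∑.sum-replicate-zero f)))
        (ℤ.+-identityʳ _)

    -- x lies in the lattice iff subtracting a suitable multiple of row 0 clears
    -- coordinate 0 and puts the rest in the lattice of the minor
    uncons : ∀ {x} → Member (rowLattice M) x → ∃ λ k → x zero ≡ k ℤ.* M zero zero ×
             Member (rowLattice (minor M)) (λ j → x (suc j) ℤ.- k ℤ.* M zero (suc j))
    uncons {x} (a , p) = a zero , trans (p zero) (column₀ a) , (a ∘ suc) , λ j → trans
      (cong (λ z → z ℤ.- a zero ℤ.* M zero (suc j)) (p (suc j)))
      (ℤ-Ring.xyx⁻¹≈y (a zero ℤ.* M zero (suc j)) _)

    cons : ∀ {x} k → x zero ≡ k ℤ.* M zero zero →
           Member (rowLattice (minor M)) (λ j → x (suc j) ℤ.- k ℤ.* M zero (suc j)) →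
           Member (rowLattice M) x
    cons {x} k eq (a , p) = (k Vector.∷ a) , λ where
        zero    → trans eq (sym (column₀ (k Vector.∷ a)))
        (suc j) → trans (solve 2 (λ y z → y := z :+ (y :- z)) refl (x (suc j)) (k ℤ.* M zero (suc j)))
                        (cong (ℤ._+_ (k ℤ.* M zero (suc j))) (p j))
      where open ℤSolver.+-*-Solver

  to-cong : ∀ {f} (M : Matrix f f) (T : Triangular M) {x y} →
            Member (rowLattice M) (λ j → x j ℤ.- y j) → toResidue M T x ≡ toResidue M T y
  to-cong {zero}  M T p = refl
  to-cong {suc f} M T {x} {y} p with uncons M T p
  ... | k , eq , rest = cong₂ (combine {d})
          (Fin.toℕ-injective (trans (Fin.toℕ-fromℕ< _) (trans same (sym (Fin.toℕ-fromℕ< _)))))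
          (to-cong (minor M) (minor-triangular T)
            {λ j → x (suc j) ℤ.- qx ℤ.* M zero (suc j)} {λ j → y (suc j) ℤ.- qy ℤ.* M zero (suc j)}
            (Subgroup.resp (rowLattice (minor M)) tails rest))
    where
    open ℤSolver.+-*-Solver
    d = ∣ M zero zero ∣
    instance
      d≢0 : ℕ.NonZero d
      d≢0 = positive⇒nonZero (Triangular.positive T zero)
    x₀ = x zero
    y₀ = y zero
    qx = x₀ /ℕ d
    qy = y₀ /ℕ d
    d≡ : + d ≡ M zero zero
    d≡ = positive⇒abs (Triangular.positive T zero)

    balance : + (x₀ %ℕ d) ≡ + (y₀ %ℕ d) ℤ.+ (k ℤ.+ qy ℤ.- qx) ℤ.* + d
    balance = trans (solve 2 (λ r q → r := (r :+ q) :- q) refl (+ (x₀ %ℕ d)) (qx ℤ.* + d))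
      (trans (cong (λ z → z ℤ.- qx ℤ.* + d) (sym (ℤ.a≡a%ℕn+[a/ℕn]*n x₀ d)))
      (trans (cong (λ z → z ℤ.- qx ℤ.* + d)
               (solve 2 (λ x y → x := y :+ (x :- y)) refl x₀ y₀))
      (trans (cong₂ (λ z w → (z ℤ.+ w) ℤ.- qx ℤ.* + d) (ℤ.a≡a%ℕn+[a/ℕn]*n y₀ d)
               (trans eq (cong (ℤ._*_ k) (sym d≡))))
      (solve 5 (λ r qy k d qx → ((r :+ qy :* d) :+ k :* d) :- qx :* d
                              := r :+ (k :+ qy :- qx) :* d)
         refl (+ (y₀ %ℕ d)) qy k (+ d) qx))))

    same : x₀ %ℕ d ≡ y₀ %ℕ d
    same = remainder-unique d _ _ (k ℤ.+ qy ℤ.- qx) (ℤ.n%ℕd<d x₀ d) (ℤ.n%ℕd<d y₀ d) balance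

    k≡ : k ≡ qx ℤ.- qy
    k≡ = trans (solve 3 (λ k qy qx → k := (k :+ qy :- qx) :+ (qx :- qy)) refl k qy qx)
           (trans (cong (λ z → z ℤ.+ (qx ℤ.- qy)) zero-coefficient) (ℤ.+-identityˡ _))
      where
      zero-coefficient : k ℤ.+ qy ℤ.- qx ≡ 0ℤ
      zero-coefficient = ℤ.*-cancelʳ-≡ _ 0ℤ (+ d) (trans
        (sym (ℤ-Ring.xyx⁻¹≈y (+ (y₀ %ℕ d)) _))
        (trans (cong (λ z → z ℤ.- + (y₀ %ℕ d)) (sym balance))
          (trans (cong (λ z → + z ℤ.- + (y₀ %ℕ d)) same) (ℤ.+-inverseʳ (+ (y₀ %ℕ d))))))

    tails : ∀ j → (x (suc j) ℤ.- y (suc j)) ℤ.- k ℤ.* M zero (suc j)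
                ≡ (x (suc j) ℤ.- qx ℤ.* M zero (suc j)) ℤ.- (y (suc j) ℤ.- qy ℤ.* M zero (suc j))
    tails j = trans (cong (λ z → (x (suc j) ℤ.- y (suc j)) ℤ.- z ℤ.* M zero (suc j)) k≡)
      (solve 5 (λ x y a b m → (x :- y) :- (a :- b) :* m := (x :- a :* m) :- (y :- b :* m))
         refl (x (suc j)) (y (suc j)) qx qy (M zero (suc j)))

  to-from : ∀ {f} (M : Matrix f f) (T : Triangular M) k → toResidue M T (fromResidue M k) ≡ k
  to-from {zero}  M T zero = refl
  to-from {suc f} M T k = trans
      (cong₂ combine
        (Fin.toℕ-injective (trans (Fin.toℕ-fromℕ< _) (ℕ.m<n⇒m%n≡m (Fin.toℕ<n r))))
        (trans (to-cong (minor M) (minor-triangular T) {_} {y} tail≈) (to-from (minor M) (minor-triangular T) k′)))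
      (Fin.combine-remQuot {d} (diagonalProduct (minor M)) k)
    where
    open ℤSolver.+-*-Solver
    d = ∣ M zero zero ∣
    instance
      d≢0 : ℕ.NonZero d
      d≢0 = positive⇒nonZero (Triangular.positive T zero)
    r  = proj₁ (remQuot {d} (diagonalProduct (minor M)) k)
    k′ = proj₂ (remQuot {d} (diagonalProduct (minor M)) k)
    y  = fromResidue (minor M) k′
    tail≈ : Member (rowLattice (minor M))
              (λ j → (y j ℤ.- ((+ toℕ r) /ℕ d) ℤ.* M zero (suc j)) ℤ.- y j)
    tail≈ = Subgroup.resp (rowLattice (minor M)) (λ j → sym (vanish j))
              (Subgroup.ε-closed (rowLattice (minor M)))
      where
      vanish : ∀ j → (y j ℤ.- ((+ toℕ r) /ℕ d) ℤ.* M zero (suc j)) ℤ.- y j ≡ 0ℤ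
      vanish j = trans
        (cong (λ q → (y j ℤ.- (+ q) ℤ.* M zero (suc j)) ℤ.- y j) (ℕ.m<n⇒m/n≡0 (Fin.toℕ<n r)))
        (solve 2 (λ y m → (y :- con 0ℤ :* m) :- y := con 0ℤ) refl (y j) (M zero (suc j)))

  from-to : ∀ {f} (M : Matrix f f) (T : Triangular M) x →
            Member (rowLattice M) (λ j → fromResidue M (toResidue M T x) j ℤ.- x j)
  from-to {zero}  M T x = (λ ()) , λ ()
  from-to {suc f} M T x = subst (λ y → Member (rowLattice M) (λ j → y j ℤ.- x j)) (sym digits)
      (cons M T (ℤ.- q) head (Subgroup.resp (rowLattice (minor M)) tail
        (from-to (minor M) (minor-triangular T) x′)))
    where
    open ℤSolver.+-*-Solver
    d = ∣ M zero zero ∣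
    instance
      d≢0 : ℕ.NonZero d
      d≢0 = positive⇒nonZero (Triangular.positive T zero)
    q = x zero /ℕ d
    x′ : Vector ℤ f
    x′ j = x (suc j) ℤ.- q ℤ.* M zero (suc j)
    r = fromℕ< (ℤ.n%ℕd<d (x zero) d)
    k = toResidue (minor M) (minor-triangular T) x′
    z = fromResidue (minor M) k

    digits : fromResidue M (combine r k) ≡ (+ toℕ r) Vector.∷ z
    digits = cong (λ p → (+ toℕ (proj₁ p)) Vector.∷ fromResidue (minor M) (proj₂ p))
                  (Fin.remQuot-combine r k)

    head : + toℕ (fromℕ< (ℤ.n%ℕd<d (x zero) d)) ℤ.- x zero ≡ (ℤ.- q) ℤ.* M zero zero
    head = trans (cong₂ (λ a b → + a ℤ.- b) (Fin.toℕ-fromℕ< (ℤ.n%ℕd<d (x zero) d))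
                        (ℤ.a≡a%ℕn+[a/ℕn]*n (x zero) d))
      (trans (solve 3 (λ r q d → r :- (r :+ q :* d) := (:- q) :* d) refl (+ (x zero %ℕ d)) q (+ d))
             (cong (ℤ._*_ (ℤ.- q)) (positive⇒abs (Triangular.positive T zero))))

    tail : ∀ j → z j ℤ.- x′ j ≡ (z j ℤ.- x (suc j)) ℤ.- (ℤ.- q) ℤ.* M zero (suc j)
    tail j = solve 4 (λ z x q m → z :- (x :- q :* m) := (z :- x) :- (:- q) :* m)
               refl (z j) (x (suc j)) q (M zero (suc j))

  finite : ∀ {f} (M : Matrix f f) → Triangular M →
           Finite (AbelianGroup.setoid (quotient (ℤ^ f) (rowLattice M)))
  finite {f} M T = record
    { order       = diagonalProduct M
    ; enumeration = record
      { to        = toResidue M T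
      ; from      = fromResidue M
      ; to-cong   = λ {x} {y} → to-cong M T {x} {y}
      ; from-cong = λ { {k} refl → Q.refl {fromResidue M k} }
      ; inverse   = (λ {k} {x} x∼ → trans (to-cong M T {x} {fromResidue M k} x∼) (to-from M T k))
                  , (λ { {x} refl → from-to M T x })
      }
    }
    where module Q = AbelianGroup (quotient (ℤ^ f) (rowLattice M))

⟨_⟩ : ∀ {f} → HNFBasis f → FiniteIndexSublattice f
⟨ M , h ⟩ = record
  { lattice = rowLattice M
  ; finite  = Residues.finite M (record { below = IsHNF.triangular h ; positive = IsHNF.positive h })
  }

-- The choices entering the universal embedding of an oriented partition.
record Choices (G : Graph) : Set where
  open Graph G
  field
    basis : CycleBasis
    root  : Fin n
    paths : ∀ v → Path root v

module _ {G : Graph} (P : OrientedPartition G) where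
  open Graph G
  open OrientedPartition P

  unit : Fin t → Vector ℤ t
  unit j i = if does (j Fin.≟ i) then 1ℤ else 0ℤ

  -- coordinate j is the net signed number of traversals of class j
  crossings : List Dart → Vector ℤ t
  crossings = List.foldr (λ d x → signed d ∙ x) ε
    where
    open AbelianGroup (ℤ^ t)
    signed : Dart → Vector ℤ t
    signed d = if isForward d then unit (class (proj₁ d)) else unit (class (proj₁ d)) ⁻¹

  cycleClassMatrix : CycleBasis → Matrix cyclomatic t
  cycleClassMatrix B i = crossings (darts (Cycle.walk (CycleBasis.cycles B i)))

  Γuniv : Choices G → AbelianGroup 0ℓ 0ℓ
  Γuniv C = quotient (ℤ^ t) (rowLattice (cycleClassMatrix (Choices.basis C)))

  generator : (C : Choices G) → Fin t → ∣ Γuniv C ∣ᴳ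
  generator C = unit

  label : (C : Choices G) → Fin n → ∣ Γuniv C ∣ᴳ
  label C v = crossings (darts (Path.walk (Choices.paths C v)))

-- An identification Γ ≅ T × ℤ^f, such as the one read off from a Smith normal form.
record Splitting (Γ : AbelianGroup 0ℓ 0ℓ) (f : ℕ) : Set₁ where
  field
    T       : AbelianGroup 0ℓ 0ℓ
    finiteT : Finite (AbelianGroup.setoid T)

  T×ℤ^f : AbelianGroup 0ℓ 0ℓ
  T×ℤ^f = DirectProduct.abelianGroup T (ℤ^ f)

  open GroupMorphisms (AbelianGroup.rawGroup Γ) (AbelianGroup.rawGroup T×ℤ^f)

  field
    split : ∣ Γ ∣ᴳ → ∣ T ∣ᴳ × Vector ℤ f
    isIso : IsGroupIsomorphism split

  torsion : ∣ Γ ∣ᴳ → ∣ T ∣ᴳ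
  torsion = proj₁ ∘ split

  free : ∣ Γ ∣ᴳ → Vector ℤ f
  free = proj₂ ∘ split

record FiniteQuotient (Γ : AbelianGroup 0ℓ 0ℓ) : Set₁ where
  field
    group      : AbelianGroup 0ℓ 0ℓ
    finite     : Finite (AbelianGroup.setoid group)

  open GroupMorphisms (AbelianGroup.rawGroup Γ) (AbelianGroup.rawGroup group)

  field
    π          : ∣ Γ ∣ᴳ → ∣ group ∣ᴳ
    isHom      : IsGroupHomomorphism π
    surjective : Surjective (AbelianGroup._≈_ Γ) (AbelianGroup._≈_ group) π

  open Finite finite public using (order)

  InKernel : ∣ Γ ∣ᴳ → Set
  InKernel x = AbelianGroup._≈_ group (π x) (AbelianGroup.ε group)

module _ {Γ : AbelianGroup 0ℓ 0ℓ} {f} (I : Splitting Γ f) where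
  open Splitting I
  private
    module T = AbelianGroup T
    module Γ = AbelianGroup Γ
    module ι = GroupMorphisms.IsGroupIsomorphism isIso

  -- the subgroup 0 × L of Γ
  inFreePart : Subgroup (ℤ^ f) → Subgroup Γ
  inFreePart L = record
    { Member    = λ x → torsion x T.≈ T.ε × Member L (free x)
    ; resp      = λ x≈y (p , q) → let (e , e′) = ι.⟦⟧-cong x≈y in
                    T.trans (T.sym e) p , Subgroup.resp L e′ q
    ; ε-closed  = let (e , e′) = ι.ε-homo in
                    e , Subgroup.resp L (λ i → sym (e′ i)) (Subgroup.ε-closed L)
    ; ∙-closed  = λ {x} {y} (p , q) (p′ , q′) → let (e , e′) = ι.∙-homo x y in
                    T.trans e (T.trans (T.∙-cong p p′) (T.identityˡ T.ε))
                  , Subgroup.resp L (λ i → sym (e′ i)) (Subgroup.∙-closed L q q′)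
    ; ⁻¹-closed = λ {x} (p , q) → let (e , e′) = ι.⁻¹-homo x in
                    T.trans e (T.trans (T.⁻¹-cong p) (AbelianGroupProperties.ε⁻¹≈ε T))
                  , Subgroup.resp L (λ i → sym (e′ i)) (Subgroup.⁻¹-closed L q)
    }

  -- Only such quotients can be of the form Γ/L with L ⊆ ℤ^f: those that leave the
  -- torsion part intact.  The condition holds automatically when T is trivial.
  KernelInFreePart : FiniteQuotient Γ → Set
  KernelInFreePart Q = ∀ x → FiniteQuotient.InKernel Q x → torsion x T.≈ T.ε

  HasKernel : FiniteQuotient Γ → FiniteIndexSublattice f → Set
  HasKernel Q L = ∀ x →
    FiniteQuotient.InKernel Q x ⇔ Member (inFreePart (FiniteIndexSublattice.lattice L)) x

  -- Γ/L has order |T| times the index of L.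
  fold : FiniteIndexSublattice f → FiniteQuotient Γ
  fold L = record
    { group      = Γ/L
    ; finite     = record
      { order       = FT.order ℕ.* FL.order
      ; enumeration = record
        { to        = to
        ; from      = from
        ; to-cong   = to-cong
        ; from-cong = λ { refl → Γ/L.refl }
        ; inverse   = (λ {k} x∼ → trans (to-cong x∼) (to-from k)) , (λ { {x} refl → from-to x })
        }
      }
    ; π          = λ x → x
    ; isHom      = record
      { isMonoidHomomorphism = record
        { isMagmaHomomorphism = record
          { isRelHomomorphism = record { cong = ≈⇒∼ }
          ; homo = λ x y → Γ/L.refl
          }
        ; ε-homo = Γ/L.refl
        }
      ; ⁻¹-homo = λ x → Γ/L.refl
      }
    ; surjective = λ x → x , ≈⇒∼
    }
    where
    open FiniteIndexSublattice L
    N = inFreePart lattice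
    Γ/L = quotient Γ N
    module Γ/L = AbelianGroup Γ/L
    module FT = Finite finiteT
    module FL = Finite finite

    ≈⇒∼ : ∀ {x y} → x Γ.≈ y → x Γ/L.≈ y
    ≈⇒∼ x≈y = Subgroup.resp N (Γ.sym (AbelianGroupProperties.x≈y⇒x∙y⁻¹≈ε Γ x≈y)) (Subgroup.ε-closed N)

    torsion-homo : ∀ x y → torsion (x Γ.∙ y Γ.⁻¹) T.≈ torsion x T.∙ torsion y T.⁻¹
    torsion-homo x y = T.trans (proj₁ (ι.∙-homo x (y Γ.⁻¹))) (T.∙-congˡ (proj₁ (ι.⁻¹-homo y)))

    free-homo : ∀ x y i → free (x Γ.∙ y Γ.⁻¹) i ≡ free x i ℤ.- free y i
    free-homo x y i = trans (proj₂ (ι.∙-homo x (y Γ.⁻¹)) i)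
                            (cong (ℤ._+_ (free x i)) (proj₂ (ι.⁻¹-homo y) i))

    to : ∣ Γ ∣ᴳ → Fin (FT.order ℕ.* FL.order)
    to x = combine (FT.to (torsion x)) (FL.to (free x))

    lift : ∣ T ∣ᴳ → Vector ℤ f → ∣ Γ ∣ᴳ
    lift s y = proj₁ (ι.surjective (s , y))

    split-lift : ∀ s y → torsion (lift s y) T.≈ s × (∀ i → free (lift s y) i ≡ y i)
    split-lift s y = proj₂ (ι.surjective (s , y)) Γ.refl

    from : Fin (FT.order ℕ.* FL.order) → ∣ Γ ∣ᴳ
    from k = lift (FT.from (proj₁ (remQuot FL.order k))) (FL.from (proj₂ (remQuot {FT.order} FL.order k)))

    to-cong : ∀ {x y} → x Γ/L.≈ y → to x ≡ to y
    to-cong {x} {y} (p , q) = cong₂ combine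
      (FT.to-cong (AbelianGroupProperties.x∙y⁻¹≈ε⇒x≈y T _ _ (T.trans (T.sym (torsion-homo x y)) p)))
      (FL.to-cong (Subgroup.resp lattice (free-homo x y) q))

    to-from : ∀ k → to (from k) ≡ k
    to-from k = trans (cong₂ combine
        (FT.inverseˡ (proj₁ (split-lift s y)))
        (FL.inverseˡ (reflexive (proj₂ (split-lift s y)))))
      (Fin.combine-remQuot {FT.order} FL.order k)
      where
      s = FT.from (proj₁ (remQuot FL.order k))
      y = FL.from (proj₂ (remQuot {FT.order} FL.order k))
      reflexive : ∀ {x y : Vector ℤ f} → x ≗ y → Member lattice (λ i → x i ℤ.- y i)
      reflexive {x} {y} x≗y = Subgroup.resp lattice
        (λ i → sym (ℤ-Ring.x≈y⇒x∙y⁻¹≈ε (x≗y i))) (Subgroup.ε-closed lattice)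

    from-to : ∀ x → from (to x) Γ/L.≈ x
    from-to x = subst (λ p → lift (FT.from (proj₁ p)) (FL.from (proj₂ p)) Γ/L.≈ x)
      (sym (Fin.remQuot-combine (FT.to (torsion x)) (FL.to (free x))))
      ( T.trans (torsion-homo _ x) (AbelianGroupProperties.x≈y⇒x∙y⁻¹≈ε T
          (T.trans (proj₁ (split-lift s y)) (FT.inverseʳ refl)))
      , Subgroup.resp lattice
          (λ i → sym (trans (free-homo (lift s y) x i)
                            (cong (λ z → z ℤ.- free x i) (proj₂ (split-lift s y) i))))
          (FL.inverseʳ refl))
      where
      s = FT.from (FT.to (torsion x))
      y = FL.from (FL.to (free x))

module _ {G : Graph} (P : OrientedPartition G) (C : Choices G) where
  open Graph G
  open OrientedPartition P

  module _ (Q : FiniteQuotient (Γuniv P C)) where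
    open FiniteQuotient Q
    private module Q = AbelianGroup group

    label/ : Fin n → Q.Carrier
    label/ v = π (label P C v)

    generator/ : Fin t → Q.Carrier
    generator/ j = π (generator P C j)

    Connection : Q.Carrier → Set
    Connection s = ¬ s Q.≈ Q.ε × (±_ {group} generator/) s

    host : UGraph
    host = Cay group Connection

    record Isometric : Set where
      field
        injective  : ∀ u v → label/ u Q.≈ label/ v → u ≡ v
        preserving : ∀ u v k → UGraph.IsDistance ugraph u v k
                             ⇔ UGraph.IsDistance host (label/ u) (label/ v) k

    connectionList : List Q.Carrier
    connectionList = List.filter (λ s → ¬? (Finite.decidable finite s Q.ε))
      (List.tabulate generator/ ++ List.tabulate (λ j → generator/ j Q.⁻¹))

    bfsᴴ : Q.Carrier → Q.Carrier → Maybe ℕ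
    bfsᴴ = BFS.bfs (Finite.decSetoid finite) (λ h → List.map (h Q.∙_) connectionList) order

    ExactCheck : Set
    ExactCheck = ∀ u v → u Fin.< v → bfsᴳ u v ≡ bfsᴴ (label/ u) (label/ v)

    exactCheck? : Dec ExactCheck
    exactCheck? = Fin.all? λ u → Fin.all? λ v → (u Fin.<? v) →-dec
      Maybe.≡-dec ℕ._≟_ (bfsᴳ u v) (bfsᴴ (label/ u) (label/ v))

  module _ {f} (I : Splitting (Γuniv P C) f) where

    Passes : FiniteIndexSublattice f → Set
    Passes L = ExactCheck (fold I L)

    search : (bound : ℕ) → Maybe (HNFBasis f)
    search bound = List.find (λ H → exactCheck? (fold I ⟨ H ⟩))
      (List.concatMap (hnfBases f) (List.applyUpTo suc bound))

diamond : Graph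
diamond = record
  { n        = 4
  ; m        = 5
  ; end₁     = end₁
  ; end₂     = end₂
  ; loopless = Dec.toWitness {a? = Fin.all? λ e → ¬? (end₁ e Fin.≟ end₂ e)} _
  ; simple   = simple
  }
  where
  end₁ end₂ : Fin 5 → Fin 4
  end₁ = Vector.fromList (# 0 ∷ # 2 ∷ # 0 ∷ # 1 ∷ # 1 ∷ [])
  end₂ = Vector.fromList (# 1 ∷ # 3 ∷ # 2 ∷ # 3 ∷ # 2 ∷ [])

  simple : ∀ e e′ →
    (end₁ e ≡ end₁ e′ × end₂ e ≡ end₂ e′) ⊎ (end₁ e ≡ end₂ e′ × end₂ e ≡ end₁ e′) → e ≡ e′
  simple = Dec.toWitness {a? = Fin.all? λ e → Fin.all? λ e′ →
    (((end₁ e Fin.≟ end₁ e′) ×-dec (end₂ e Fin.≟ end₂ e′)) Dec.⊎-dec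
     ((end₁ e Fin.≟ end₂ e′) ×-dec (end₂ e Fin.≟ end₁ e′))) →-dec (e Fin.≟ e′)} _

diamondPartition : OrientedPartition diamond
diamondPartition = record
  { t       = 3
  ; class   = class
  ; onto    = Dec.toWitness {a? = Fin.all? λ j → Fin.any? λ e → class e Fin.≟ j} _
  ; forward = λ _ → true
  }
  where
  class : Fin 5 → Fin 3
  class = Vector.fromList (# 0 ∷ # 0 ∷ # 1 ∷ # 1 ∷ # 2 ∷ [])

pair : ∀ {A : Set} → A → A → Vector A 2
pair a b = Vector.fromList (a ∷ b ∷ [])

diamondGenerators : Fin 3 → Vector ℤ 2
diamondGenerators = Vector.fromList (pair (+ 1) (+ 0) ∷ pair (+ 1) (+ 1) ∷ pair (+ 0) (+ 1) ∷ [])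

diamondLabels : Fin 4 → Vector ℤ 2
diamondLabels = Vector.fromList
  (pair (+ 0) (+ 0) ∷ pair (+ 1) (+ 0) ∷ pair (+ 1) (+ 1) ∷ pair (+ 2) (+ 1) ∷ [])

multiples : ℕ → Subgroup ℤ.+-0-abelianGroup
multiples k = record
  { Member    = λ x → (+ k) ℤ.∣ x
  ; resp      = λ { refl p → p }
  ; ε-closed  = k ℕ.∣0
  ; ∙-closed  = λ {x} {y} p q → Signed.∣⇒∣ᵤ {+ k} {x ℤ.+ y}
                  (Signed.∣m∣n⇒∣m+n {+ k} {x} {y} (Signed.∣ᵤ⇒∣ {+ k} {x} p) (Signed.∣ᵤ⇒∣ {+ k} {y} q))
  ; ⁻¹-closed = λ {x} p → subst (k ℕ.∣_) (sym (ℤ.∣-i∣≡∣i∣ x)) p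
  }

ℤmod : ℕ → AbelianGroup 0ℓ 0ℓ
ℤmod k = quotient ℤ.+-0-abelianGroup (multiples k)

ℤ₂×ℤ₃ : AbelianGroup 0ℓ 0ℓ
ℤ₂×ℤ₃ = DirectProduct.abelianGroup (ℤmod 2) (ℤmod 3)

-- The graph K₂,₂,₂, with parts indexed by the first coordinate.
octahedron : UGraph
octahedron = record
  { vertices = ≡.setoid (Fin 3 × Fin 2)
  ; Adj      = λ u v → proj₁ u ≢ proj₁ v
  }

octahedronConnection : ∣ ℤ₂×ℤ₃ ∣ᴳ → Set
octahedronConnection = ±_ {ℤ₂×ℤ₃} (Vector.fromList ((+ 0 , + 1) ∷ (+ 1 , + 1) ∷ []))

optimalBasis : Matrix 2 2
optimalBasis = Vector.fromList (pair (+ 3) (+ 0) ∷ pair (+ 1) (+ 2) ∷ [])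

{-# OPTIONS --safe #-}

-- A finite quotient whose kernel lies in the free part is determined up to isomorphism
-- by the sublattice L of ℤ^f it kills, and L has a Hermite normal form; distances in the
-- host depend only on the kernel, and breadth-first search computes them.  The search
-- through the Hermite normal forms by increasing index therefore stops at a minimal host.
--
-- For the diamond, every basis contains a cycle through the edge 1–2, so that the relations
-- are exactly the multiples of (1, −1, 1).  A quotient is isometric iff its kernel contains
-- none of eight vectors ("forbidden" below): differences of labels, and differences by which
-- 0 and 3 would become adjacent.  They separate six points, whence the bound 6; for diagonal
-- lattices they leave room for a box of 8 or 9 incongruent points.
module Submission where

open import Defs
open import Level using (0ℓ)
open import Algebra.Bundles using (AbelianGroup)
import Algebra.Construct.Terminal as Terminal
open import Algebra.Morphism.Structures using (module GroupMorphisms)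
import Algebra.Properties.AbelianGroup as AbelianGroupProperties
import Algebra.Properties.Semiring.Sum as SemiringSum
open import Data.Bool using (Bool; true; false; _∧_; _∨_; if_then_else_)
import Data.Bool.Properties as Bool
open import Data.Empty using (⊥)
open import Data.Fin as Fin using (Fin; zero; suc; toℕ; #_)
open import Data.Fin.Patterns using (0F; 1F; 2F)
import Data.Fin.Properties as Fin
open import Data.Integer as ℤ using (ℤ; +_; -[1+_]; 0ℤ; 1ℤ; -1ℤ; ∣_∣; _/ℕ_; _%ℕ_)
import Data.Integer.Divisibility as ℤ
import Data.Integer.Divisibility.Signed as Signed
import Data.Integer.DivMod as ℤ
import Data.Integer.Properties as ℤ
import Data.Integer.Solver as ℤSolver
open import Data.List as List using (List; []; _∷_; _++_)
import Data.List.Membership.DecSetoid as DecMembership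
open import Data.List.Membership.Propositional using (_∈_; find; lose)
import Data.List.Membership.Propositional.Properties as Membership
import Data.List.Membership.Setoid.Properties as SetoidMembership
import Data.List.Relation.Unary.All as All
open import Data.List.Relation.Unary.AllPairs using ([]; _∷_)
open import Data.List.Relation.Unary.Any as Any using (Any; here; there)
import Data.List.Relation.Unary.Any.Properties as Any
import Data.List.Relation.Unary.Unique.DecPropositional as DecUnique
open import Data.List.Relation.Unary.Unique.Propositional using (Unique)
open import Data.Maybe using (Maybe; just; nothing)
import Data.Maybe.Properties as Maybe
import Data.Maybe.Relation.Unary.Any as MaybeAny
open import Data.Nat as ℕ using (ℕ; zero; suc; _≤_; _<_; z≤n; s≤s)
import Data.Nat.Divisibility as ℕ
import Data.Nat.DivMod as ℕ
import Data.Nat.Properties as ℕ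
open import Data.Product using (∃; _×_; _,_; proj₁; proj₂)
open import Data.Sum as Sum using (_⊎_; inj₁; inj₂)
open import Data.Unit.Polymorphic using (tt)
open import Data.Vec.Functional as Vector using (Vector)
open import Function using (_∘_; id)
open import Function.Bundles using (_⇔_; mk⇔; Equivalence)
import Function.Properties.Equivalence as ⇔
open import Relation.Binary using (DecSetoid; Setoid; Decidable; tri<; tri≈; tri>)
open import Relation.Binary.PropositionalEquality
  using (_≡_; _≢_; _≗_; refl; sym; trans; cong; cong₂; subst; subst₂)
open import Relation.Nullary using (¬_; Dec; yes; no; ¬?; contradiction)
import Relation.Nullary.Decidable as Dec
open import Relation.Nullary.Decidable using (_×-dec_; _→-dec_; _⊎-dec_)
import Relation.Unary as Unary

open Equivalence using (to; from)
open FiniteIndexSublattice using (lattice; index)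
open Subgroup using (Member)
open ℤSolver.+-*-Solver using (solve; con; _:=_; _:+_; _:*_; _:-_; :-_)

-- Walks and breadth-first search

-- Quotients are compared through their kernels in `Γuniv`, because the quotient groups are
-- arbitrary setoids without common elements. The order of a fold is |T| times the index, so
-- increasing index means increasing order. A finite quotient has decidable equality, hence a kernel
-- with decidable membership; this makes the least leading entry in the Hermite reduction
-- computable, so that the kernel of any isometric quotient supplies a bound at which the search
-- succeeds. Vectors and matrices are functions, so a basis occurs on the list only up to entrywise
-- equality, and passing the check is carried over by kernels.
--
-- For the diamond eight vectors suffice because the diameter is 2: edges stay edges as long as
-- labels stay distinct, so only a collapse of labels or a shortcut between 0 and 3 can spoil
-- isometry. Differences of labels give (1,0), (0,1), (1,1), (2,1) up to sign; (2,1) plus or minus a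
-- generator adds (3,1), (3,2), (2,0), (2,2). The six separated points are the four labels and the
-- negatives of the labels of 1 and 2.

least : ∀ {P : ℕ → Set} → Unary.Decidable P → ∀ n → P n → ∃ λ m → P m × (∀ {j} → P j → m ≤ j)
least P? zero    p = zero , p , λ _ → z≤n
least {P} P? (suc n) p with P? zero
... | yes p₀ = zero , p₀ , λ _ → z≤n
... | no ¬p₀ with m , q , minimal ← least (λ j → P? (suc j)) n p = suc m , q , suc-minimal
  where
  suc-minimal : ∀ {j} → P j → suc m ≤ j
  suc-minimal {zero}  p₀ = contradiction p₀ ¬p₀
  suc-minimal {suc j} pⱼ = s≤s (minimal pⱼ)

module Walks (U : UGraph) where
  open UGraph U
  private module S = Setoid vertices

  distance-unique : ∀ {u v k l} → IsDistance u v k → IsDistance u v l → k ≡ l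
  distance-unique (p , minp) (q , minq) = ℕ.≤-antisym (minp q) (minq p)

  module _ (adj-respʳ : ∀ {u v w} → Adj u v → v ≈ⱽ w → Adj u w)
           (adj-respˡ : ∀ {u v w} → u ≈ⱽ v → Adj v w → Adj u w) where

    walk-respˡ : ∀ {k u v w} → u ≈ⱽ v → WalkOfLength k v w → WalkOfLength k u w
    walk-respˡ u≈v (stop v≈w)  = stop (S.trans u≈v v≈w)
    walk-respˡ u≈v (step a vw) = step (adj-respˡ u≈v a) vw

    snoc : ∀ {k u v w} → WalkOfLength k u v → Adj v w → WalkOfLength (suc k) u w
    snoc (stop u≈v)  a = step (adj-respˡ u≈v a) (stop S.refl)
    snoc (step b vw) a = step b (snoc vw a)

    unsnoc : ∀ {k u w} → WalkOfLength (suc k) u w → ∃ λ v → WalkOfLength k u v × Adj v w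
    unsnoc (step a (stop v≈w)) = _ , stop S.refl , adj-respʳ a v≈w
    unsnoc (step a p@(step _ _)) with _ , q , b ← unsnoc p = _ , step a q , b

    walk-respʳ : ∀ {k u v w} → WalkOfLength k u v → v ≈ⱽ w → WalkOfLength k u w
    walk-respʳ (stop u≈v)  v≈w = stop (S.trans u≈v v≈w)
    walk-respʳ (step a vw) v≈w = step a (walk-respʳ vw v≈w)

    distance-resp : ∀ {k u u′ v v′} → u ≈ⱽ u′ → v ≈ⱽ v′ → IsDistance u v k → IsDistance u′ v′ k
    distance-resp u≈ v≈ (p , minimal) =
      walk-respˡ (S.sym u≈) (walk-respʳ p v≈) ,
      λ q → minimal (walk-respˡ u≈ (walk-respʳ q (S.sym v≈)))

    module _ (adj-sym : ∀ {u v} → Adj u v → Adj v u) where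

      reverse : ∀ {k u v} → WalkOfLength k u v → WalkOfLength k v u
      reverse (stop u≈v) = stop (S.sym u≈v)
      reverse (step a p) = snoc (reverse p) (adj-sym a)

      distance-sym : ∀ {k u v} → IsDistance u v k → IsDistance v u k
      distance-sym (p , minimal) = reverse p , λ q → minimal (reverse q)

vertexDecSetoid : (U : UGraph) → Decidable (UGraph._≈ⱽ_ U) → DecSetoid 0ℓ 0ℓ
vertexDecSetoid U _≟_ = record
  { isDecEquivalence = record { isEquivalence = Setoid.isEquivalence (UGraph.vertices U) ; _≟_ = _≟_ } }

-- Abstract in the graph, so that it serves both `G` and the hosts, whose vertices are equal only
-- modulo a kernel. The injection `number` bounds the fuel.
module BreadthFirst
  (U : UGraph) (_≟_ : Decidable (UGraph._≈ⱽ_ U)) (nbrs : UGraph.V U → List (UGraph.V U))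
  (adj⇔ : ∀ {u v} → UGraph.Adj U u v ⇔ DecMembership._∈_ (vertexDecSetoid U _≟_) v (nbrs u))
  (adj-respˡ : ∀ {u v w} → UGraph._≈ⱽ_ U u v → UGraph.Adj U v w → UGraph.Adj U u w)
  {order : ℕ} (number : UGraph.V U → Fin order)
  (number-injective : ∀ {u v} → number u ≡ number v → UGraph._≈ⱽ_ U u v)
  where

  open UGraph U
  private
    S : DecSetoid 0ℓ 0ℓ
    S = vertexDecSetoid U _≟_
  open Walks U
  private module S = DecSetoid S
  open BFS S nbrs
  open DecMembership S using () renaming (_∈_ to _∈ˢ_; _∈?_ to _∈ˢ?_; find to findˢ; lose to loseˢ; _∉_ to _∉ˢ_)

  adj-respʳ : ∀ {u v w} → Adj u v → v ≈ⱽ w → Adj u w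
  adj-respʳ a v≈w = from adj⇔ (SetoidMembership.∈-resp-≈ S.setoid v≈w (to adj⇔ a))

  walk? : ∀ k u v → Dec (WalkOfLength k u v)
  walk? zero    u v = Dec.map′ stop (λ { (stop u≈v) → u≈v }) (u ≟ v)
  walk? (suc k) u v = Dec.map′
    (λ any → let _ , w∈ , p = findˢ any in step (from adj⇔ w∈) p)
    (λ { (step a p) → loseˢ (λ u≈v → walk-respˡ adj-respʳ adj-respˡ (S.sym u≈v)) (to adj⇔ a) p })
    (Any.any? (λ w → walk? k w v) (nbrs u))

  distance-exists : ∀ {ℓ u v} → WalkOfLength ℓ u v → ∃ λ k → IsDistance u v k
  distance-exists {ℓ} {u} {v} p with k , q , minimal ← least (λ k → walk? k u v) ℓ p = k , q , minimal

  -- A shorter walk to `v`, prolonged by the last edge, would be a shorter walk to `w`.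
  penultimate : ∀ {k u w} → IsDistance u w (suc k) → ∃ λ v → IsDistance u v k × Adj v w
  penultimate (p , minimal) with v , q , a ← unsnoc adj-respʳ adj-respˡ p =
    v , (q , λ r → ℕ.≤-pred (minimal (snoc adj-respʳ adj-respˡ r a))) , a

  intermediate : ∀ {k u w} → IsDistance u w k → ∀ {j} → j ≤ k → ∃ λ v → IsDistance u v j
  intermediate {zero}  d z≤n = _ , d
  intermediate {suc k} d j≤ with ℕ.m≤n⇒m<n∨m≡n j≤
  ... | inj₂ refl     = _ , d
  ... | inj₁ (s≤s j≤) = intermediate (proj₁ (proj₂ (penultimate d))) j≤

  -- The vertices at distances 0, …, k from u are pairwise distinct.
  distance<order : ∀ {u v k} → IsDistance u v k → k < order
  distance<order {u} {v} {k} d = Fin.injective⇒≤ {f = λ i → number (proj₁ (at i))} injective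
    where
    at : (i : Fin (suc k)) → ∃ λ w → IsDistance u w (toℕ i)
    at i = intermediate d (Fin.toℕ≤pred[n] i)

    injective : ∀ {i j} → number (proj₁ (at i)) ≡ number (proj₁ (at j)) → i ≡ j
    injective {i} {j} eq = Fin.toℕ-injective (distance-unique
      (distance-resp adj-respʳ adj-respˡ S.refl (number-injective eq) (proj₂ (at i)))
      (proj₂ (at j)))

  module _ (s : V) where

    -- The loop invariant of `layers` at depth `d`. `Visited` speaks of walks shorter than `d`
    -- rather than of distances, so no shortest walk has to be extracted to maintain it.
    Visited Frontier : ℕ → List V → Set
    Visited  d xs = ∀ x → x ∈ˢ xs ⇔ ∃ λ j → j < d × WalkOfLength j s x
    Frontier d ys = ∀ x → x ∈ˢ ys ⇔ IsDistance s x d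

    module _ {d} {visited frontier : List V} (vis : Visited d visited) (fro : Frontier d frontier) where

      private
        frontier∉ : List V
        frontier∉ = List.filter (λ v → ¬? (v ∈ˢ? (frontier ++ visited))) (List.concatMap nbrs frontier)

        respects : ∀ {x y} → x ≈ⱽ y → x ∉ˢ (frontier ++ visited) → y ∉ˢ (frontier ++ visited)
        respects x≈y x∉ y∈ = x∉ (SetoidMembership.∈-resp-≈ S.setoid (S.sym x≈y) y∈)

        ≟-respʳ : ∀ {x y z} → z ≈ⱽ y → x ≈ⱽ y → x ≈ⱽ z
        ≟-respʳ z≈y x≈y = S.trans x≈y (S.sym z≈y)

      visited-step : Visited (suc d) (frontier ++ visited)
      visited-step x = mk⇔ forth back
        where
        forth : x ∈ˢ (frontier ++ visited) → ∃ λ j → j < suc d × WalkOfLength j s x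
        forth x∈ with SetoidMembership.∈-++⁻ S.setoid frontier x∈
        ... | inj₁ x∈f = d , ℕ.n<1+n d , proj₁ (to (fro x) x∈f)
        ... | inj₂ x∈v with j , j<d , p ← to (vis x) x∈v = j , ℕ.m<n⇒m<1+n j<d , p

        back : (∃ λ j → j < suc d × WalkOfLength j s x) → x ∈ˢ (frontier ++ visited)
        back (j , s≤s j≤d , p) with x ∈ˢ? visited
        ... | yes x∈v = SetoidMembership.∈-++⁺ʳ S.setoid frontier x∈v
        ... | no  x∉v with ℕ.m≤n⇒m<n∨m≡n j≤d
        ...   | inj₁ j<d  = contradiction (from (vis x) (j , j<d , p)) x∉v
        ...   | inj₂ refl = SetoidMembership.∈-++⁺ˡ S.setoid (from (fro x)
                -- Being unvisited excludes every walk shorter than `d`, so this walk of length `d`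
                -- realises the distance.
                (p , λ {k} q → ℕ.≮⇒≥ λ k<j → x∉v (from (vis x) (k , k<j , q))))

      frontier-step : Frontier (suc d) (List.deduplicate _≟_ frontier∉)
      frontier-step x = mk⇔ forth back
        where
        forth : x ∈ˢ List.deduplicate _≟_ frontier∉ → IsDistance s x (suc d)
        forth x∈ with SetoidMembership.∈-filter⁻ S.setoid (λ v → ¬? (v ∈ˢ? (frontier ++ visited))) respects
                        {xs = List.concatMap nbrs frontier}
                        (SetoidMembership.∈-deduplicate⁻ S.setoid _≟_ frontier∉ x∈)
        ... | x∈nbrs , x∉ with findˢ (SetoidMembership.∈-concatMap⁻ S.setoid S.setoid {f = nbrs} x∈nbrs)
        ...   | v , v∈f , x∈v =
          snoc adj-respʳ adj-respˡ (proj₁ (to (fro v) v∈f)) (from adj⇔ x∈v) ,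
          λ {k} q → ℕ.≮⇒≥ λ k≤d → x∉ (from (visited-step x) (k , k≤d , q))

        back : IsDistance s x (suc d) → x ∈ˢ List.deduplicate _≟_ frontier∉
        back far with penultimate far
        ... | v , near , a = SetoidMembership.∈-deduplicate⁺ S.setoid _≟_ ≟-respʳ
          (SetoidMembership.∈-filter⁺ S.setoid (λ v → ¬? (v ∈ˢ? (frontier ++ visited))) respects
            (SetoidMembership.∈-concatMap⁺ S.setoid S.setoid
              (loseˢ (λ v≈w x∈v → to adj⇔ (adj-respˡ (S.sym v≈w) (from adj⇔ x∈v)))
                    (from (fro v) near) (to adj⇔ a)))
            (λ x∈ → let j , j≤d , p = to (visited-step x) x∈ in ℕ.<⇒≱ j≤d (proj₂ far p)))

    layers-sound : ∀ fuel {d visited frontier t k} → Visited d visited → Frontier d frontier →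
                   layers fuel d visited frontier t ≡ just k → IsDistance s t k
    layers-sound (suc fuel) {frontier = frontier} {t} vis fro eq with t ∈ˢ? frontier
    layers-sound (suc fuel) {t = t} vis fro refl | yes t∈ = to (fro t) t∈
    ... | no _ = layers-sound fuel (visited-step vis fro) (frontier-step vis fro) eq

    -- `fuel + d` is constant along the recursion, so the bound on `k` persists, and at fuel zero it
    -- contradicts `d ≤ k`. A target outside the frontier has `k` different from `d`, hence larger.
    layers-complete : ∀ fuel {d visited frontier t k} → Visited d visited → Frontier d frontier →
                      IsDistance s t k → d ≤ k → k < fuel ℕ.+ d →
                      layers fuel d visited frontier t ≡ just k
    layers-complete zero vis fro dist d≤k k< = contradiction d≤k (ℕ.<⇒≱ k<)
    layers-complete (suc fuel) {d} {frontier = frontier} {t} {k} vis fro dist d≤k k< with t ∈ˢ? frontier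
    ... | yes t∈ = cong just (distance-unique (to (fro t) t∈) dist)
    ... | no  t∉ = layers-complete fuel (visited-step vis fro) (frontier-step vis fro) dist
          (ℕ.≤∧≢⇒< d≤k λ { refl → t∉ (from (fro t) dist) })
          (subst (k <_) (sym (ℕ.+-suc fuel d)) k<)

    bfs⇔distance : ∀ {t k} → bfs order s t ≡ just k ⇔ IsDistance s t k
    bfs⇔distance {t} {k} = mk⇔ (layers-sound order vis₀ fro₀)
      (λ dist → layers-complete order vis₀ fro₀ dist z≤n
        (subst (k <_) (sym (ℕ.+-identityʳ order)) (distance<order dist)))
      where
      vis₀ : Visited 0 []
      vis₀ x = mk⇔ (λ ()) (λ { (_ , () , _) })
      fro₀ : Frontier 0 (s ∷ [])
      fro₀ x = mk⇔ (λ { (here x≈s) → stop (S.sym x≈s) , λ _ → z≤n })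
                   (λ { (stop s≈x , _) → here (S.sym s≈x) })

-- Hermite normal forms and their enumeration

module _ {A : Set} {P : A → Set} (P? : Unary.Decidable P) where

  find-sound : ∀ xs {x} → List.find P? xs ≡ just x → P x × x ∈ xs
  find-sound (y ∷ ys) eq with P? y
  find-sound (y ∷ ys) refl | yes p = p , here refl
  ... | no _ with p , x∈ ← find-sound ys eq = p , there x∈

  find-complete : ∀ {xs y} → y ∈ xs → P y → ∃ λ x → List.find P? xs ≡ just x
  find-complete {x ∷ xs} y∈ p with P? x
  ... | yes _ = x , refl
  find-complete (here refl) p | no ¬p = contradiction p ¬p
  find-complete (there y∈)  p | no _  = find-complete y∈ p

  find-++ : ∀ xs {ys x} → List.find P? (xs ++ ys) ≡ just x →
            x ∈ xs ⊎ ((∀ {y} → y ∈ xs → ¬ P y) × List.find P? ys ≡ just x)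
  find-++ []       eq = inj₂ ((λ ()) , eq)
  find-++ (y ∷ xs) eq with P? y
  find-++ (y ∷ xs) refl | yes _ = inj₁ (here refl)
  ... | no ¬p with find-++ xs eq
  ...   | inj₁ x∈         = inj₁ (there x∈)
  ...   | inj₂ (none , e) = inj₂ ((λ { (here refl) → ¬p ; (there y∈) → none y∈ }) , e)

  -- Minimality is by block and not by position: with one block for each index, it says that no
  -- basis of smaller index passes.
  find-first-block : ∀ (h : ℕ → List A) g n {x} →
    List.find P? (List.concatMap h (List.applyUpTo g n)) ≡ just x →
    ∃ λ i → x ∈ h (g i) × (∀ {j y} → j < i → y ∈ h (g j) → ¬ P y)
  find-first-block h g (suc n) eq with find-++ (h (g 0)) eq
  ... | inj₁ x∈ = 0 , x∈ , λ ()
  ... | inj₂ (none , eq′) with find-first-block h (λ i → g (suc i)) n eq′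
  ...   | i , x∈ , earlier = suc i , x∈ , λ { {zero} _ → none ; {suc j} (s≤s j<i) → earlier j<i }

-- Without extensionality a function can be listed only up to pointwise equality. `R` allows two
-- uses: `_≡_` between entries for the rows, then `_≗_` between rows for the matrices.
vectors-complete : ∀ {A B : Set} {R : A → B → Set} (xs : List A) k (v : Vector B k) →
  (∀ i → ∃ λ a → a ∈ xs × R a (v i)) → ∃ λ w → w ∈ vectors xs k × (∀ i → R (w i) (v i))
vectors-complete xs zero    v near = Vector.[] , here refl , λ ()
vectors-complete {R = R} xs (suc k) v near
  with a , a∈ , r ← near zero
     | w , w∈ , rs ← vectors-complete {R = R} xs k (λ i → v (suc i)) (λ i → near (suc i))
  = a Vector.∷ w , Membership.∈-cartesianProductWith⁺ Vector._∷_ a∈ w∈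
  , λ { zero → r ; (suc i) → rs i }

_≗₂_ : ∀ {k l} → Matrix k l → Matrix k l → Set
M ≗₂ M′ = ∀ i j → M i j ≡ M′ i j

HNF-resp : ∀ {f} {M M′ : Matrix f f} → M′ ≗₂ M → IsHNF M → IsHNF M′
HNF-resp eq (mkHNF t p r) = mkHNF
  (λ i j j<i → trans (eq i j) (t i j j<i))
  (λ i → subst (0ℤ ℤ.<_) (sym (eq i i)) (p i))
  (λ i j i<j → subst (0ℤ ℤ.≤_) (sym (eq i j)) (proj₁ (r i j i<j)) ,
    subst₂ ℤ._<_ (sym (eq i j)) (sym (eq j j)) (proj₂ (r i j i<j)))

diagonalProduct-cong : ∀ {f} {M M′ : Matrix f f} → M ≗₂ M′ → diagonalProduct M ≡ diagonalProduct M′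
diagonalProduct-cong {zero}  eq = refl
diagonalProduct-cong {suc f} {M} {M′} eq =
  cong₂ ℕ._*_ (cong ∣_∣ (eq zero zero))
    (diagonalProduct-cong {M = Residues.minor M} {Residues.minor M′} λ i j → eq (suc i) (suc j))

diagonalProduct-positive : ∀ {f} {M : Matrix f f} → (∀ i → 0ℤ ℤ.< M i i) → 0 < diagonalProduct M
diagonalProduct-positive {zero}  pos = s≤s z≤n
diagonalProduct-positive {suc f} {M} pos = ℕ.*-mono-≤
  (ℕ.>-nonZero⁻¹ _ {{Residues.positive⇒nonZero (pos zero)}})
  (diagonalProduct-positive {M = Residues.minor M} (λ i → pos (suc i)))

diagonal≤product : ∀ {f} {M : Matrix f f} → (∀ i → 0ℤ ℤ.< M i i) → ∀ i → ∣ M i i ∣ ≤ diagonalProduct M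
diagonal≤product {suc f} {M} pos zero = ℕ.m≤m*n _ _
  {{ℕ.>-nonZero (diagonalProduct-positive {M = Residues.minor M} (λ i → pos (suc i)))}}
diagonal≤product {suc f} {M} pos (suc i) = ℕ.≤-trans
  (diagonal≤product {M = Residues.minor M} (λ i → pos (suc i)) i)
  (ℕ.m≤n*m _ _ {{Residues.positive⇒nonZero (pos zero)}})

entry-bounds : ∀ {f} {M : Matrix f f} → IsHNF M → ∀ i j → 0ℤ ℤ.≤ M i j × ∣ M i j ∣ ≤ diagonalProduct M
entry-bounds {M = M} h i j with Fin.<-cmp i j
... | tri< i<j _ _ = let 0≤ , < = IsHNF.reduced h i j i<j in
  0≤ , ℕ.≤-trans
    (ℤ.drop‿+≤+ (ℤ.≤-trans (ℤ.≤-reflexive (ℤ.0≤i⇒+∣i∣≡i 0≤))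
      (ℤ.≤-trans (ℤ.<⇒≤ <) (ℤ.≤-reflexive (sym (Residues.positive⇒abs (IsHNF.positive h j)))))))
    (diagonal≤product {M = M} (IsHNF.positive h) j)
... | tri≈ _ refl _ = ℤ.<⇒≤ (IsHNF.positive h i) , diagonal≤product {M = M} (IsHNF.positive h) i
... | tri> _ _ j<i rewrite IsHNF.triangular h i j j<i = ℤ.+≤+ z≤n , z≤n

private
  -- A name for the local function of hnfBases.
  keep : ∀ f N → ∃ λ g → hnfBases f N ≡ List.mapMaybe g (vectors (vectors (List.map +_ (List.upTo (suc N))) f) f)
  keep f N = _ , refl

  -- The list carries the proof computed by `isHNF?`, which may differ from the given one; hence the
  -- existential.
  keep-just : ∀ f N M → IsHNF M → diagonalProduct M ≡ N → ∃ λ h → proj₁ (keep f N) M ≡ just (M , h)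
  keep-just f N M h eq with isHNF? M ×-dec (diagonalProduct M ℕ.≟ N)
  ... | yes (h′ , _) = h′ , refl
  ... | no ¬p        = contradiction (h , eq) ¬p

  keep-index : ∀ f N M {H} → proj₁ (keep f N) M ≡ just H → diagonalProduct (proj₁ H) ≡ N
  keep-index f N M eq with isHNF? M ×-dec (diagonalProduct M ℕ.≟ N)
  keep-index f N M refl | yes (_ , e) = e

mapMaybe-∈⁺ : ∀ {A B : Set} (g : A → Maybe B) {x y xs} → x ∈ xs → g x ≡ just y → y ∈ List.mapMaybe g xs
mapMaybe-∈⁺ g {y = y} x∈ eq = Any.mapMaybe⁺ g _ (Any.map⁺
  (Any.map (λ { refl → subst (MaybeAny.Any (y ≡_)) (sym eq) (MaybeAny.just refl) }) x∈))

mapMaybe-∈⁻ : ∀ {A B : Set} (g : A → Maybe B) xs {y} → y ∈ List.mapMaybe g xs → ∃ λ x → g x ≡ just y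
mapMaybe-∈⁻ g (x ∷ xs) y∈ with g x in eq
... | nothing = mapMaybe-∈⁻ g xs y∈
mapMaybe-∈⁻ g (x ∷ xs) (here refl) | just _ = x , eq
mapMaybe-∈⁻ g (x ∷ xs) (there y∈)  | just _ = mapMaybe-∈⁻ g xs y∈

hnfBases-index : ∀ {f N} {H : HNFBasis f} → H ∈ hnfBases f N → diagonalProduct (proj₁ H) ≡ N
hnfBases-index {f} {N} H∈
  with M , eq ← mapMaybe-∈⁻ (proj₁ (keep f N)) (vectors (vectors (List.map +_ (List.upTo (suc N))) f) f) H∈
  = keep-index f N M eq

entry-listed : ∀ {f} {M : Matrix f f} → IsHNF M → ∀ i j →
  ∃ λ a → a ∈ List.map +_ (List.upTo (suc (diagonalProduct M))) × a ≡ M i j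
entry-listed {M = M} h i j with 0≤ , ≤N ← entry-bounds h i j =
  + ∣ M i j ∣ , Membership.∈-map⁺ +_ (Membership.∈-upTo⁺ (s≤s ≤N)) , ℤ.0≤i⇒+∣i∣≡i 0≤

abstract
  hnfBases-complete : ∀ {f} (H : HNFBasis f) →
    ∃ λ (H′ : HNFBasis f) → H′ ∈ hnfBases f (diagonalProduct (proj₁ H)) × proj₁ H′ ≗₂ proj₁ H
  hnfBases-complete {f} (M , h)
    with M′ , M′∈ , M′≗ ← vectors-complete {R = _≗_} _ f M (λ i →
                               vectors-complete {R = _≡_} _ f (M i) (entry-listed h i))
    with h′ , eq ← keep-just f (diagonalProduct M) M′ (HNF-resp M′≗ h) (diagonalProduct-cong {M = M′} {M} M′≗)
    = (M′ , h′) , mapMaybe-∈⁺ (proj₁ (keep f _)) M′∈ eq , M′≗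

rowLattice-cong : ∀ {c t} {A A′ : Matrix c t} → A ≗₂ A′ → ∀ x →
                  Member (rowLattice A) x → Member (rowLattice A′) x
rowLattice-cong eq x (a , p) = a , λ j →
  trans (p j) (∑.sum-cong-≗ λ i → cong (ℤ._*_ (a i)) (eq i j))
  where
  module ∑ = SemiringSum ℤ.+-*-semiring

·-closed : ∀ {f} (L : Subgroup (ℤ^ f)) (k : ℤ) {x : Vector ℤ f} →
           Member L x → Member L (λ i → k ℤ.* x i)
·-closed L k {x} p = multiple k
  where
  open Subgroup L

  natural : ∀ n → Member L (λ i → + n ℤ.* x i)
  natural zero    = resp (λ i → refl) ε-closed
  natural (suc n) = resp (λ i → sym (ℤ.suc-* (+ n) (x i))) (∙-closed p (natural n))

  multiple : ∀ k → Member L (λ i → k ℤ.* x i)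
  multiple (+ n)    = natural n
  multiple -[1+ n ] = resp (λ i → ℤ.neg-distribˡ-* (+ suc n) (x i)) (⁻¹-closed (natural (suc n)))

-- These bounds are the condition `reduced` of a Hermite normal form; a row whose tail is a
-- mixed-radix residue is therefore already reduced.
fromResidue-reduced : ∀ {f} (M : Matrix f f) k j →
  0ℤ ℤ.≤ Residues.fromResidue M k j × Residues.fromResidue M k j ℤ.< + ∣ M j j ∣
fromResidue-reduced {suc f} M k zero    = ℤ.+≤+ z≤n , ℤ.+<+ (Fin.toℕ<n _)
fromResidue-reduced {suc f} M k (suc j) = fromResidue-reduced (Residues.minor M) _ j

tailPart : ∀ {f} → Subgroup (ℤ^ (suc f)) → Subgroup (ℤ^ f)
tailPart L = record
  { Member    = λ y → Member L (0ℤ Vector.∷ y)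
  ; resp      = λ eq → resp λ { zero → refl ; (suc j) → eq j }
  ; ε-closed  = resp (λ { zero → refl ; (suc j) → refl }) ε-closed
  ; ∙-closed  = λ p q → resp (λ { zero → refl ; (suc j) → refl }) (∙-closed p q)
  ; ⁻¹-closed = λ p → resp (λ { zero → refl ; (suc j) → refl }) (⁻¹-closed p)
  }
  where open Subgroup L

-- Finite index in a form that passes to `tailPart` without counting cosets.
Torsion : ∀ {f} → Subgroup (ℤ^ f) → Set
Torsion {f} L = ∀ (x : Vector ℤ f) → ∃ λ n → Member L (λ i → + suc n ℤ.* x i)

-- The first row has the least positive leading entry d that occurs in L; every
-- leading entry is then a multiple of d, and the remaining rows come from the
-- vectors of L with leading entry 0.
hermite : ∀ f (L : Subgroup (ℤ^ f)) → Unary.Decidable (Member L) → Torsion L →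
          ∃ λ (H : HNFBasis f) → L ≐ rowLattice (proj₁ H)
hermite zero L L? tor =
  (Vector.[] , mkHNF (λ ()) (λ ()) (λ ())) ,
  λ x → mk⇔ (λ _ → (λ ()) , λ ()) (λ _ → Subgroup.resp L (λ ()) (Subgroup.ε-closed L))
hermite (suc f) L L? tor = extend
  (hermite f (tailPart L) (λ y → L? (0ℤ Vector.∷ y))
    (λ y → let n , p = tor (0ℤ Vector.∷ y) in
       n , resp {λ i → + suc n ℤ.* (0ℤ Vector.∷ y) i} (λ { zero → ℤ.*-zeroʳ (+ suc n) ; (suc j) → refl }) p))
  where
  open Subgroup L

  extend : (∃ λ (H : HNFBasis f) → tailPart L ≐ rowLattice (proj₁ H)) →
           ∃ λ (H : HNFBasis (suc f)) → L ≐ rowLattice (proj₁ H)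
  extend ((M′ , h′) , L₀≐) = (M , h) , λ x → mk⇔ (⊆ x) (⊇ x)
    where
    T′ : Residues.Triangular M′
    T′ = record { below = IsHNF.triangular h′ ; positive = IsHNF.positive h′ }

    Leading : ℕ → Set
    Leading d = ∃ λ k → Member L (+ suc d Vector.∷ Residues.fromResidue M′ k)

    -- Adding a vector of `tailPart L` changes the tail alone, so the tail may be replaced by its
    -- residue.
    leading : ∀ d {x : Vector ℤ (suc f)} → x zero ≡ + suc d → Member L x → Leading d
    leading d {x} eq p = Residues.toResidue M′ T′ y ,
      resp (λ { zero → trans (ℤ.+-identityˡ _) eq
              ; (suc j) → solve 2 (λ z y → (z :- y) :+ y := z) refl _ (y j) })
        (∙-closed (from (L₀≐ _) (Residues.from-to M′ T′ y)) p)
      where y = λ j → x (suc j)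

    smallest : ∃ λ d → Leading d × (∀ {j} → Leading j → d ≤ j)
    -- A positive multiple of the first unit vector lies in `L`; this gives a leading entry at which
    -- the search for the least one may stop.
    smallest = let n , p = tor (1ℤ Vector.∷ λ _ → 0ℤ) in
      least (λ d → Fin.any? λ k → L? _) n
        (leading n {λ i → + suc n ℤ.* (1ℤ Vector.∷ λ _ → 0ℤ) i} (ℤ.*-identityʳ (+ suc n)) p)

    d = proj₁ smallest
    k = proj₁ (proj₁ (proj₂ smallest))

    row₀ : Vector ℤ (suc f)
    row₀ = + suc d Vector.∷ Residues.fromResidue M′ k

    row₀∈L : Member L row₀
    row₀∈L = proj₂ (proj₁ (proj₂ smallest))

    M : Matrix (suc f) (suc f)
    M = row₀ Vector.∷ λ i → 0ℤ Vector.∷ M′ i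

    h : IsHNF M
    h = mkHNF
      (λ { (suc i) zero _ → refl ; (suc i) (suc j) (s≤s j<i) → IsHNF.triangular h′ i j j<i })
      (λ { zero → ℤ.+<+ (s≤s z≤n) ; (suc i) → IsHNF.positive h′ i })
      (λ { zero (suc j) _ → let 0≤ , < = fromResidue-reduced M′ k j in
             0≤ , subst (Residues.fromResidue M′ k j ℤ.<_) (Residues.positive⇒abs (IsHNF.positive h′ j)) <
         ; (suc i) (suc j) (s≤s i<j) → IsHNF.reduced h′ i j i<j })

    T : Residues.Triangular M
    T = record { below = IsHNF.triangular h ; positive = IsHNF.positive h }

    ⊇ : ∀ x → Member (rowLattice M) x → Member L x
    ⊇ x p with q , eq , rest ← Residues.uncons M T p = resp
      (λ { zero → trans (ℤ.+-identityʳ _) (sym eq)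
         ; (suc j) → solve 2 (λ m x → m :+ (x :- m) := x) refl (q ℤ.* row₀ (suc j)) (x (suc j)) })
      (∙-closed (·-closed L q row₀∈L) (from (L₀≐ _) rest))

    ⊆ : ∀ x → Member L x → Member (rowLattice M) x
    ⊆ x p = conclude (x zero %ℕ suc d) refl
      where
      q = x zero /ℕ suc d

      division : x zero ≡ + (x zero %ℕ suc d) ℤ.+ q ℤ.* + suc d
      division = ℤ.a≡a%ℕn+[a/ℕn]*n (x zero) (suc d)

      x′ : Vector ℤ (suc f)
      x′ i = x i ℤ.- q ℤ.* row₀ i

      x′∈L : Member L x′
      x′∈L = ∙-closed p (⁻¹-closed (·-closed L q row₀∈L))

      conclude : ∀ r → x zero %ℕ suc d ≡ r → Member (rowLattice M) x
      conclude zero eq = Residues.cons M T q exact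
        (to (L₀≐ _) (resp (λ { zero → trans (cong (ℤ._- q ℤ.* + suc d) exact) (ℤ.+-inverseʳ (q ℤ.* + suc d))
                             ; (suc j) → refl }) x′∈L))
        where
        exact : x zero ≡ q ℤ.* + suc d
        exact = trans division (trans (cong (λ r → + r ℤ.+ q ℤ.* + suc d) eq) (ℤ.+-identityˡ _))
      -- A nonzero remainder `suc r` is itself a leading entry in `L`, smaller than the least one
      -- `suc d`.
      conclude (suc r) eq = contradiction
        (proj₂ (proj₂ smallest) (leading r
          (trans (cong (ℤ._- q ℤ.* + suc d) division)
            (trans (solve 2 (λ r m → (r :+ m) :- m := r) refl (+ (x zero %ℕ suc d)) (q ℤ.* + suc d))
                   (cong +_ eq)))
          x′∈L))
        (ℕ.<⇒≱ (ℕ.≤-pred (subst (_< suc d) eq (ℤ.n%ℕd<d (x zero) (suc d)))))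

-- Finite quotients and their hosts

module FiniteSetoid {S : Setoid 0ℓ 0ℓ} (F : Finite S) where
  open Setoid S using (_≈_)
  private module S = Setoid S

  number-injective : ∀ {x y} → Finite.to F x ≡ Finite.to F y → x ≈ y
  number-injective eq = S.trans (S.sym (Finite.inverseʳ F refl)) (Finite.inverseʳ F eq)

  numeral-injective : ∀ {i j} → Finite.from F i ≈ Finite.from F j → i ≡ j
  numeral-injective eq = trans (sym (Finite.inverseˡ F S.refl)) (Finite.inverseˡ F eq)

-- Among 0·x, 1·x, …, N·x two have the same number.
torsion : ∀ {f N} (L : Subgroup (ℤ^ f)) (number : Vector ℤ f → Fin N) →
          (∀ {x y} → number x ≡ number y → Member L (λ i → x i ℤ.- y i)) → Torsion L
torsion {N = N} L number separates x
  with i , j , i<j , eq ← Fin.pigeonhole (ℕ.n<1+n N) (λ i → number (λ k → + toℕ i ℤ.* x k))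
  = toℕ j ℕ.∸ suc (toℕ i) , Subgroup.resp L (λ k → difference (x k) i<j) (separates (sym eq))
  where
  difference : ∀ z {i j} → i < j → + j ℤ.* z ℤ.- + i ℤ.* z ≡ + suc (j ℕ.∸ suc i) ℤ.* z
  difference z {i} {j} i<j = trans
    (cong (λ n → + n ℤ.* z ℤ.- + i ℤ.* z) (sym (ℕ.m∸n+n≡m i<j)))
    (trans (cong (λ n → n ℤ.* z ℤ.- + i ℤ.* z)
             (trans (cong +_ (ℕ.+-suc (j ℕ.∸ suc i) i)) (ℤ.pos-+ (suc (j ℕ.∸ suc i)) i)))
           (solve 3 (λ a b z → (a :+ b) :* z :- b :* z := a :* z) refl (+ suc (j ℕ.∸ suc i)) (+ i) z))

module _ {Γ : AbelianGroup 0ℓ 0ℓ} where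
  private module Γ = AbelianGroup Γ

  module Quotient (R : FiniteQuotient Γ) where
    open FiniteQuotient R
    module Q = AbelianGroup group
    module π = GroupMorphisms.IsGroupHomomorphism isHom

    π-quotient : ∀ x y → π (x Γ.∙ y Γ.⁻¹) Q.≈ π x Q.∙ π y Q.⁻¹
    π-quotient x y = Q.trans (π.homo x (y Γ.⁻¹)) (Q.∙-congˡ (π.⁻¹-homo y))

    kernel⇔ : ∀ {x y} → InKernel (x Γ.∙ y Γ.⁻¹) ⇔ π x Q.≈ π y
    kernel⇔ {x} {y} = mk⇔
      (λ p → AbelianGroupProperties.x∙y⁻¹≈ε⇒x≈y group _ _ (Q.trans (Q.sym (π-quotient x y)) p))
      (λ eq → Q.trans (π-quotient x y) (AbelianGroupProperties.x≈y⇒x∙y⁻¹≈ε group eq))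

  -- Representatives of the distinct classes of `R′` stay distinct in `R`, because `R` identifies
  -- less. This injection compares the orders without any index formula.
  order-antitone : (R R′ : FiniteQuotient Γ) →
    (∀ {x} → FiniteQuotient.InKernel R x → FiniteQuotient.InKernel R′ x) →
    FiniteQuotient.order R′ ≤ FiniteQuotient.order R
  order-antitone R R′ ⊆ = Fin.injective⇒≤ {f = Finite.to R.finite ∘ R.π ∘ representative} λ eq →
    FiniteSetoid.numeral-injective R′.finite (Q′.trans (Q′.sym (represents _)) (Q′.trans
      (to (Quotient.kernel⇔ R′) (⊆ (from (Quotient.kernel⇔ R) (FiniteSetoid.number-injective R.finite eq))))
      (represents _)))
    where
    module R = FiniteQuotient R
    module R′ = FiniteQuotient R′
    module Q′ = AbelianGroup R′.group

    representative : Fin R′.order → Γ.Carrier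
    representative i = proj₁ (R′.surjective (Finite.from R′.finite i))

    represents : ∀ i → R′.π (representative i) Q′.≈ Finite.from R′.finite i
    represents i = proj₂ (R′.surjective (Finite.from R′.finite i)) Γ.refl

  module Splits {f} (I : Splitting Γ f) where
    private
      module I = Splitting I
      module T = AbelianGroup I.T
      module ι = GroupMorphisms.IsGroupIsomorphism I.isIso

    fold-kernel : ∀ L x → FiniteQuotient.InKernel (fold I L) x ⇔
                  Member (inFreePart I (FiniteIndexSublattice.lattice L)) x
    fold-kernel L x = mk⇔ (resp x-ε≈x) (resp (Γ.sym x-ε≈x))
      where
      open Subgroup (inFreePart I (FiniteIndexSublattice.lattice L))
      x-ε≈x : x Γ.∙ Γ.ε Γ.⁻¹ Γ.≈ x
      x-ε≈x = Γ.trans (Γ.∙-congˡ (AbelianGroupProperties.ε⁻¹≈ε Γ)) (Γ.identityʳ x)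

    -- The inclusion of 0 × ℤ^f in `Γ`. Surjectivity of the splitting only provides preimages; that
    -- they form a homomorphism follows from `lift-unique`.
    lift : Vector ℤ f → Γ.Carrier
    lift y = proj₁ (ι.surjective (T.ε , y))

    lift-torsion : ∀ y → I.torsion (lift y) T.≈ T.ε
    lift-torsion y = proj₁ (proj₂ (ι.surjective (T.ε , y)) Γ.refl)

    lift-free : ∀ y → I.free (lift y) ≗ y
    lift-free y = proj₂ (proj₂ (ι.surjective (T.ε , y)) Γ.refl)

    lift-unique : ∀ {x y} → I.torsion x T.≈ T.ε → I.free x ≗ y → lift y Γ.≈ x
    lift-unique {x} {y} p q = ι.injective
      (T.trans (lift-torsion y) (T.sym p) , λ i → trans (lift-free y i) (sym (q i)))

    lift-ε : lift (λ _ → 0ℤ) Γ.≈ Γ.ε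
    lift-ε = lift-unique (proj₁ ι.ε-homo) (proj₂ ι.ε-homo)

    lift-∙ : ∀ x y → lift (λ i → x i ℤ.+ y i) Γ.≈ lift x Γ.∙ lift y
    lift-∙ x y = lift-unique
      (T.trans (proj₁ (ι.∙-homo _ _)) (T.trans (T.∙-cong (lift-torsion x) (lift-torsion y)) (T.identityˡ T.ε)))
      (λ i → trans (proj₂ (ι.∙-homo _ _) i) (cong₂ ℤ._+_ (lift-free x i) (lift-free y i)))

    lift-⁻¹ : ∀ x → lift (λ i → ℤ.- x i) Γ.≈ lift x Γ.⁻¹
    lift-⁻¹ x = lift-unique
      (T.trans (proj₁ (ι.⁻¹-homo _)) (T.trans (T.⁻¹-cong (lift-torsion x)) (AbelianGroupProperties.ε⁻¹≈ε I.T)))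
      (λ i → trans (proj₂ (ι.⁻¹-homo _) i) (cong ℤ.-_ (lift-free x i)))

    module _ (R : FiniteQuotient Γ) where
      open FiniteQuotient R
      open Quotient R

      freeKernel : Subgroup (ℤ^ f)
      freeKernel = record
        { Member    = λ y → InKernel (lift y)
        ; resp      = λ x≗y p → Q.trans (π.⟦⟧-cong (lift-unique (lift-torsion _)
                        (λ i → trans (lift-free _ i) (x≗y i)))) p
        ; ε-closed  = Q.trans (π.⟦⟧-cong lift-ε) π.ε-homo
        ; ∙-closed  = λ {x} {y} p q → Q.trans (π.⟦⟧-cong (lift-∙ x y))
                        (Q.trans (π.homo _ _) (Q.trans (Q.∙-cong p q) (Q.identityˡ Q.ε)))
        ; ⁻¹-closed = λ {x} p → Q.trans (π.⟦⟧-cong (lift-⁻¹ x))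
                        (Q.trans (π.⁻¹-homo _) (Q.trans (Q.⁻¹-cong p) (AbelianGroupProperties.ε⁻¹≈ε group)))
        }

      freeKernel-torsion : Torsion freeKernel
      freeKernel-torsion = torsion freeKernel (λ y → Finite.to finite (π (lift y))) λ {x} {y} eq →
        Q.trans (π.⟦⟧-cong (Γ.trans (lift-∙ x (λ i → ℤ.- y i)) (Γ.∙-congˡ (lift-⁻¹ y))))
          (from (kernel⇔ {lift x} {lift y}) (FiniteSetoid.number-injective finite eq))

      abstract
        -- An element `x` of the kernel has trivial torsion part, so it is `lift` of its free part,
        -- and the kernel can be read off in ℤ^f as `freeKernel`. Decidable equality in the finite
        -- group makes `hermite` applicable.
        kernel-hermite : KernelInFreePart I R → ∃ λ (H : HNFBasis f) → HasKernel I R ⟨ H ⟩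
        kernel-hermite intact with H , ≐ ← hermite f freeKernel
                                           (λ y → Finite.decidable finite _ _) freeKernel-torsion =
          H , λ x → mk⇔
            (λ p → intact x p , to (≐ _) (Q.trans (π.⟦⟧-cong (lift-unique (intact x p) λ _ → refl)) p))
            (λ (p , q) → Q.trans (Q.sym (π.⟦⟧-cong (lift-unique p λ _ → refl))) (from (≐ _) q))

-- Exact check, isometry and dependence on the kernel

module GraphSearch (G : Graph) where
  open Graph G

  private
    -- A name for the local function of neighbours.
    around : ∀ u → ∃ λ g → neighbours u ≡ List.concatMap g (List.allFin m)
    around u = _ , refl

    around⁺ : ∀ u (d : Dart) → source d ≡ u → target d ∈ proj₁ (around u) (proj₁ d)
    around⁺ u (e , true) refl with end₁ e Fin.≟ end₁ e
    ... | yes _ = here refl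
    ... | no ¬p = contradiction refl ¬p
    around⁺ u (e , false) refl with end₂ e Fin.≟ end₂ e
    ... | yes _ = Membership.∈-++⁺ʳ (if Dec.does (end₁ e Fin.≟ end₂ e) then end₂ e ∷ [] else []) (here refl)
    ... | no ¬p = contradiction refl ¬p

    around⁻ : ∀ u e {v} → v ∈ proj₁ (around u) e → UGraph.Adj ugraph u v
    around⁻ u e v∈ with end₁ e Fin.≟ u | end₂ e Fin.≟ u
    around⁻ u e (here refl)         | yes p | _     = (e , true) , p , refl
    around⁻ u e (there (here refl)) | yes p | yes q = (e , false) , q , refl
    around⁻ u e (here refl)         | no _  | yes q = (e , false) , q , refl

  adj⇔ : ∀ {u v} → UGraph.Adj ugraph u v ⇔ v ∈ neighbours u
  adj⇔ {u} = mk⇔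
    (λ { (d , p , refl) → Any.concatMap⁺ (proj₁ (around u)) (lose (Membership.∈-allFin _) (around⁺ u d p)) })
    (λ v∈ → let e , _ , v∈e = find (Any.concatMap⁻ (proj₁ (around u)) {xs = List.allFin m} v∈) in around⁻ u e v∈e)

  adj-respˡ : ∀ {u v w} → u ≡ v → UGraph.Adj ugraph v w → UGraph.Adj ugraph u w
  adj-respˡ refl a = a

  open BreadthFirst ugraph Fin._≟_ neighbours adj⇔ adj-respˡ id id public

  adj-sym : ∀ {u v} → UGraph.Adj ugraph u v → UGraph.Adj ugraph v u
  adj-sym ((e , true)  , p , q) = (e , false) , q , p
  adj-sym ((e , false) , p , q) = (e , true) , q , p

  dist-sym : ∀ {k u v} → UGraph.IsDistance ugraph u v k → UGraph.IsDistance ugraph v u k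
  dist-sym = Walks.distance-sym ugraph adj-respʳ adj-respˡ adj-sym

  walk-length : ∀ {u v} → Walk u v → ∃ λ k → UGraph.WalkOfLength ugraph k u v
  walk-length []           = 0 , UGraph.stop refl
  walk-length (step d p w) = let k , w′ = walk-length w in suc k , UGraph.step (d , p , refl) w′

module Hosts {G : Graph} (P : OrientedPartition G) (C : Choices G) where
  open Graph G
  open OrientedPartition P
  private
    module Γ = AbelianGroup (Γuniv P C)
    module GS = GraphSearch G

  module Search (R : FiniteQuotient (Γuniv P C)) where
    open FiniteQuotient R
    open Quotient R
    private H = host P C R
    open UGraph H
    private
      S = Finite.decSetoid finite
      module S = DecMembership S
      nonzero? = λ s → ¬? (Finite.decidable finite s Q.ε)
      nonzero-resp : ∀ {s s′} → s Q.≈ s′ → ¬ s Q.≈ Q.ε → ¬ s′ Q.≈ Q.ε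
      nonzero-resp eq s≉ε s′≈ε = s≉ε (Q.trans eq s′≈ε)
      g = generator/ P C R

    connection⇔ : ∀ {s} → Connection P C R s ⇔ s S.∈ connectionList P C R
    connection⇔ {s} = mk⇔ forth back
      where
      forth : Connection P C R s → s S.∈ connectionList P C R
      forth (s≉ε , j , inj₁ eq) = SetoidMembership.∈-filter⁺ Q.setoid nonzero? nonzero-resp
        (SetoidMembership.∈-++⁺ˡ Q.setoid (Any.tabulate⁺ j eq)) s≉ε
      forth (s≉ε , j , inj₂ eq) = SetoidMembership.∈-filter⁺ Q.setoid nonzero? nonzero-resp
        (SetoidMembership.∈-++⁺ʳ Q.setoid (List.tabulate g) (Any.tabulate⁺ j eq)) s≉ε
      back : s S.∈ connectionList P C R → Connection P C R s
      back s∈ with SetoidMembership.∈-filter⁻ Q.setoid nonzero? nonzero-resp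
                     {xs = List.tabulate g ++ List.tabulate (λ j → g j Q.⁻¹)} s∈
      ... | s∈ , s≉ε with SetoidMembership.∈-++⁻ Q.setoid (List.tabulate g) s∈
      ...   | inj₁ p = let j , eq = Any.tabulate⁻ p in s≉ε , j , inj₁ eq
      ...   | inj₂ p = let j , eq = Any.tabulate⁻ p in s≉ε , j , inj₂ eq

    adj⇔ : ∀ {h k} → Adj h k ⇔ k S.∈ List.map (h Q.∙_) (connectionList P C R)
    adj⇔ {h} = mk⇔
      (λ (s , c , eq) → SetoidMembership.∈-resp-≈ Q.setoid (Q.sym eq)
        (SetoidMembership.∈-map⁺ Q.setoid Q.setoid Q.∙-congˡ (to connection⇔ c)))
      (λ k∈ → let s , s∈ , eq = SetoidMembership.∈-map⁻ Q.setoid Q.setoid k∈ in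
        s , from connection⇔ s∈ , eq)

    adj-respˡ : ∀ {h k l} → h Q.≈ k → Adj k l → Adj h l
    adj-respˡ h≈k (s , c , eq) = s , c , Q.trans eq (Q.∙-congʳ (Q.sym h≈k))

    open BreadthFirst H (Finite.decidable finite) (λ h → List.map (h Q.∙_) (connectionList P C R))
      adj⇔ adj-respˡ (Finite.to finite) (FiniteSetoid.number-injective finite) public

    connection-⁻¹ : ∀ {s} → Connection P C R s → Connection P C R (s Q.⁻¹)
    connection-⁻¹ {s} (s≉ε , j , eq) =
      (λ eq′ → s≉ε (Q.trans (Q.sym (⁻¹-involutive s)) (Q.trans (Q.⁻¹-cong eq′) ε⁻¹≈ε))) ,
      j , Sum.swap (Sum.map Q.⁻¹-cong (λ p → Q.trans (Q.⁻¹-cong p) (⁻¹-involutive _)) eq)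
      where open AbelianGroupProperties group

    adj-sym : ∀ {h k} → Adj h k → Adj k h
    adj-sym {h} {k} (s , c , eq) = s Q.⁻¹ , connection-⁻¹ c ,
      Q.sym (Q.trans (Q.∙-congʳ eq) (Q.trans (Q.assoc h s (s Q.⁻¹))
        (Q.trans (Q.∙-congˡ (Q.inverseʳ s)) (Q.identityʳ h))))

    dist-sym : ∀ {k u v} → IsDistance u v k → IsDistance v u k
    dist-sym = Walks.distance-sym H adj-respʳ adj-respˡ adj-sym

    zero-distance : ∀ {u v} → u Q.≈ v → ∀ {k} → IsDistance u v k ⇔ k ≡ 0
    zero-distance u≈v = mk⇔
      (λ (_ , minimal) → ℕ.n≤0⇒n≡0 (minimal (stop u≈v)))
      (λ { refl → stop u≈v , λ _ → z≤n })

    -- Injectivity is preservation of distance 0.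
    preserving⇒isometric :
      (∀ u v k → UGraph.IsDistance ugraph u v k ⇔ IsDistance (label/ P C R u) (label/ P C R v) k) →
      Isometric P C R
    preserving⇒isometric preserving = record
      { injective  = λ u v eq → stopped (proj₁ (from (preserving u v 0) (stop eq , λ _ → z≤n)))
      ; preserving = preserving
      }
      where
      stopped : ∀ {u v} → UGraph.WalkOfLength ugraph 0 u v → u ≡ v
      stopped (UGraph.stop eq) = eq

    module _ (connected : Connected) where

      distance : ∀ u v → ∃ λ k → UGraph.IsDistance ugraph u v k
      distance u v = GS.distance-exists (proj₂ (GS.walk-length (connected u v)))

      -- Connectedness provides a distance `k`, so both searches return `just k`.
      isometric⇒exact : Isometric P C R → ExactCheck P C R
      isometric⇒exact iso u v _ with k , d ← distance u v = trans
        (from (GS.bfs⇔distance u) d)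
        (sym (from (bfs⇔distance _) (to (Isometric.preserving iso u v k) d)))

      exact⇒isometric : ExactCheck P C R → Isometric P C R
      exact⇒isometric exact = preserving⇒isometric preserving
        where
        ascending : ∀ {u v} → u Fin.< v → ∀ k →
          UGraph.IsDistance ugraph u v k ⇔ IsDistance (label/ P C R u) (label/ P C R v) k
        ascending {u} {v} u<v k = mk⇔
          (λ d → to (bfs⇔distance _) (trans (sym (exact u v u<v)) (from (GS.bfs⇔distance u) d)))
          (λ d → to (GS.bfs⇔distance u) (trans (exact u v u<v) (from (bfs⇔distance _) d)))

        preserving : ∀ u v k →
          UGraph.IsDistance ugraph u v k ⇔ IsDistance (label/ P C R u) (label/ P C R v) k
        preserving u v k with Fin.<-cmp u v
        ... | tri< u<v _ _  = ascending u<v k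
        ... | tri> _ _ v<u  = mk⇔ (λ d → dist-sym (to (ascending v<u k) (GS.dist-sym d)))
                                  (λ d → GS.dist-sym (from (ascending v<u k) (dist-sym d)))
        ... | tri≈ _ refl _ = mk⇔
          (λ (_ , minimal) → from (zero-distance Q.refl) (ℕ.n≤0⇒n≡0 (minimal (UGraph.stop refl))))
          (λ d → subst (UGraph.IsDistance ugraph u u) (sym (to (zero-distance Q.refl) d))
                       (UGraph.stop refl , λ _ → z≤n))

  module Transfer (R R′ : FiniteQuotient (Γuniv P C))
                  (kernel : ∀ x → FiniteQuotient.InKernel R x ⇔ FiniteQuotient.InKernel R′ x) where
    private
      module R = FiniteQuotient R
      module R′ = FiniteQuotient R′
      module Q = AbelianGroup R.group
      module Q′ = AbelianGroup R′.group
      module QR = Quotient R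
      module QR′ = Quotient R′

    π-transfer : ∀ {x y} → R.π x Q.≈ R.π y → R′.π x Q′.≈ R′.π y
    π-transfer eq = to QR′.kernel⇔ (to (kernel _) (from QR.kernel⇔ eq))

    -- Up to equality `s` is the image of a generator or its inverse, and the same element of
    -- `Γuniv` serves in `R′`; its image there is nonzero since the kernels agree.
    connection-lift : ∀ {s} → Connection P C R s → ∃ λ x → s Q.≈ R.π x × Connection P C R′ (R′.π x)
    connection-lift {s} (s≉ε , j , eq) = lifted eq
      where
      nonzero : ∀ {x} → s Q.≈ R.π x → ¬ R′.π x Q′.≈ Q′.ε
      nonzero eq eq′ = s≉ε (Q.trans eq (from (kernel _) eq′))
      lifted : s Q.≈ R.π (generator P C j) ⊎ s Q.≈ R.π (generator P C j) Q.⁻¹ →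
               ∃ λ x → s Q.≈ R.π x × Connection P C R′ (R′.π x)
      lifted (inj₁ eq) = generator P C j , eq , nonzero eq , j , inj₁ Q′.refl
      lifted (inj₂ eq) = generator P C j Γ.⁻¹ , eq′ , nonzero eq′ , j , inj₂ (QR′.π.⁻¹-homo _)
        where eq′ = Q.trans eq (Q.sym (QR.π.⁻¹-homo _))

    -- The endpoints are tracked by preimages in `Γuniv`, the only place where the two groups meet.
    walk-transfer : ∀ {k h l} → UGraph.WalkOfLength (host P C R) k h l →
                    ∀ {x y} → R.π x Q.≈ h → R.π y Q.≈ l →
                    UGraph.WalkOfLength (host P C R′) k (R′.π x) (R′.π y)
    walk-transfer (UGraph.stop h≈l) x≈h y≈l =
      UGraph.stop (π-transfer (Q.trans x≈h (Q.trans h≈l (Q.sym y≈l))))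
    walk-transfer (UGraph.step (s , c , eq) w) {x} x≈h y≈l
      with z , s≈z , c′ ← connection-lift c =
      UGraph.step (R′.π z , c′ , QR′.π.homo x z)
        (walk-transfer w (Q.trans (QR.π.homo x z)
          (Q.sym (Q.trans eq (Q.∙-cong (Q.sym x≈h) s≈z)))) y≈l)

  isometric-resp : (R R′ : FiniteQuotient (Γuniv P C)) →
    (∀ x → FiniteQuotient.InKernel R x ⇔ FiniteQuotient.InKernel R′ x) →
    Isometric P C R → Isometric P C R′
  isometric-resp R R′ kernel iso = Search.preserving⇒isometric R′ λ u v k → mk⇔
    (λ d → transfer (to (Isometric.preserving iso u v k) d))
    (λ d → from (Isometric.preserving iso u v k) (transfer′ d))
    where
    module Q = AbelianGroup (FiniteQuotient.group R)
    module Q′ = AbelianGroup (FiniteQuotient.group R′)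
    there-walk = Transfer.walk-transfer R R′ kernel
    back-walk  = Transfer.walk-transfer R′ R (λ x → ⇔.sym (kernel x))
    transfer : ∀ {u v k} → UGraph.IsDistance (host P C R) (label/ P C R u) (label/ P C R v) k →
               UGraph.IsDistance (host P C R′) (label/ P C R′ u) (label/ P C R′ v) k
    transfer (w , minimal) = there-walk w Q.refl Q.refl , λ w′ → minimal (back-walk w′ Q′.refl Q′.refl)
    transfer′ : ∀ {u v k} → UGraph.IsDistance (host P C R′) (label/ P C R′ u) (label/ P C R′ v) k →
                UGraph.IsDistance (host P C R) (label/ P C R u) (label/ P C R v) k
    transfer′ (w , minimal) = back-walk w Q′.refl Q′.refl , λ w′ → minimal (there-walk w′ Q.refl Q.refl)

-- Correctness, success and minimality of the search

module Enumeration {G : Graph} (connected : Graph.Connected G)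
                   (P : OrientedPartition G) (C : Choices G) {f} (I : Splitting (Γuniv P C) f) where
  open Hosts P C
  open Splits I

  fold-passes⇔ : (L : FiniteIndexSublattice f) → Passes P C I L ⇔ Isometric P C (fold I L)
  fold-passes⇔ L = mk⇔ (Search.exact⇒isometric (fold I L) connected)
                       (Search.isometric⇒exact (fold I L) connected)

  fold-isometric⇔ : (R : FiniteQuotient (Γuniv P C)) (L : FiniteIndexSublattice f) → HasKernel I R L →
                    Isometric P C R ⇔ Isometric P C (fold I L)
  fold-isometric⇔ R L kernel = mk⇔ (isometric-resp R (fold I L) same)
                                   (isometric-resp (fold I L) R λ x → ⇔.sym (same x))
    where
    same : ∀ x → FiniteQuotient.InKernel R x ⇔ FiniteQuotient.InKernel (fold I L) x
    same x = mk⇔ (λ p → from (fold-kernel L x) (to (kernel x) p))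
                 (λ p → from (kernel x) (to (fold-kernel L x) p))

  passes⇔isometric : (R : FiniteQuotient (Γuniv P C)) (L : FiniteIndexSublattice f) → HasKernel I R L →
                     Passes P C I L ⇔ Isometric P C R
  passes⇔isometric R L kernel = mk⇔
    (λ passes → from (fold-isometric⇔ R L kernel) (to (fold-passes⇔ L) passes))
    (λ iso → from (fold-passes⇔ L) (to (fold-isometric⇔ R L kernel) iso))

  sublattice-quotients : (R : FiniteQuotient (Γuniv P C)) →
    (Isometric P C R × KernelInFreePart I R) ⇔
    (∃ λ (L : FiniteIndexSublattice f) → HasKernel I R L × Passes P C I L)
  sublattice-quotients R = mk⇔
    (λ (iso , intact) → let H , kernel = kernel-hermite R intact in
      ⟨ H ⟩ , kernel , from (passes⇔isometric R ⟨ H ⟩ kernel) iso)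
    (λ (L , kernel , passes) →
      to (passes⇔isometric R L kernel) passes , λ x p → proj₁ (to (kernel x) p))

  HasKernel-cong : (R : FiniteQuotient (Γuniv P C)) (H H′ : HNFBasis f) → proj₁ H′ ≗₂ proj₁ H →
                   HasKernel I R ⟨ H ⟩ → HasKernel I R ⟨ H′ ⟩
  HasKernel-cong R H H′ H′≗ kernel x = mk⇔
    (λ p → let q , r = to (kernel x) p in q , rowLattice-cong (λ i j → sym (H′≗ i j)) _ r)
    (λ (q , r) → from (kernel x) (q , rowLattice-cong H′≗ _ r))

  module _ (R : FiniteQuotient (Γuniv P C)) (iso : Isometric P C R) (intact : KernelInFreePart I R) where

    private
      H : HNFBasis f
      H = proj₁ (kernel-hermite R intact)

      H-kernel : HasKernel I R ⟨ H ⟩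
      H-kernel = proj₂ (kernel-hermite R intact)

      H-index : ℕ
      H-index = diagonalProduct (proj₁ H)

      0<H-index : 0 < H-index
      0<H-index = diagonalProduct-positive {M = proj₁ H} (IsHNF.positive (proj₂ H))

      -- `search` runs through the indices `suc i`, so index `H-index` sits at position
      -- `ℕ.pred H-index`.
      suc-pred : suc (ℕ.pred H-index) ≡ H-index
      suc-pred = ℕ.suc-pred H-index {{ℕ.>-nonZero 0<H-index}}

      H′ : HNFBasis f
      H′ = proj₁ (hnfBases-complete H)

      H′-listed : H′ ∈ hnfBases f (suc (ℕ.pred H-index))
      H′-listed = subst (λ N → H′ ∈ hnfBases f N) (sym suc-pred) (proj₁ (proj₂ (hnfBases-complete H)))

      H′-passes : Passes P C I ⟨ H′ ⟩
      H′-passes = from (passes⇔isometric R ⟨ H′ ⟩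
        (HasKernel-cong R H H′ (proj₂ (proj₂ (hnfBases-complete H))) H-kernel)) iso

    search-finds : ∃ λ bound → ∃ λ (K : HNFBasis f) → search P C I bound ≡ just K
    search-finds = suc (ℕ.pred H-index) , find-complete (λ K → exactCheck? P C (fold I ⟨ K ⟩))
      (Membership.∈-concatMap⁺ (hnfBases f) (lose (Membership.∈-applyUpTo⁺ suc (ℕ.n<1+n _)) H′-listed))
      H′-passes

    -- No basis in a block before that of `K` passes, but `H′` passes; so the block of `H′` is not
    -- earlier.
    search-index : ∀ bound (K : HNFBasis f) → search P C I bound ≡ just K →
                   diagonalProduct (proj₁ K) ≤ H-index
    search-index bound K found =
      let i , K∈ , earlier = find-first-block (λ K → exactCheck? P C (fold I ⟨ K ⟩)) (hnfBases f) suc bound found in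
      ℕ.≤-trans (ℕ.≤-reflexive (hnfBases-index K∈))
        (ℕ.≤-trans (s≤s (ℕ.≮⇒≥ λ j<i → earlier j<i H′-listed H′-passes)) (ℕ.≤-reflexive suc-pred))

    -- The common factor |T| turns the comparison of indices into one of orders; the fold at `H` has
    -- the kernel of `R`, hence at most the order of `R`.
    search-minimal : ∀ bound (K : HNFBasis f) → search P C I bound ≡ just K →
                     FiniteQuotient.order (fold I ⟨ K ⟩) ≤ FiniteQuotient.order R
    search-minimal bound K found = ℕ.≤-trans
      (ℕ.*-monoʳ-≤ (Finite.order (Splitting.finiteT I)) (search-index bound K found))
      (order-antitone R (fold I ⟨ H ⟩) λ {x} p → from (fold-kernel ⟨ H ⟩ x) (to (H-kernel x) p))

  search-passes : ∀ bound (K : HNFBasis f) → search P C I bound ≡ just K → Passes P C I ⟨ K ⟩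
  search-passes bound K found = proj₁ (find-sound (λ K → exactCheck? P C (fold I ⟨ K ⟩))
    (List.concatMap (hnfBases f) (List.applyUpTo suc bound)) found)

-- The diamond graph

open Graph diamond
open OrientedPartition diamondPartition

trivialGroup : AbelianGroup 0ℓ 0ℓ
trivialGroup = Terminal.abelianGroup

∀-dart? : ∀ {A : Dart → Set} → (∀ d → Dec (A d)) → Dec (∀ d → A d)
∀-dart? A? = Dec.map′
  (λ { p (e , true) → proj₁ (p e) ; p (e , false) → proj₂ (p e) })
  (λ p e → p (e , true) , p (e , false))
  (Fin.all? λ e → A? (e , true) ×-dec A? (e , false))

signed : Dart → Vector ℤ 3
signed d = if isForward d then unit diamondPartition (class (proj₁ d))
           else λ j → ℤ.- unit diamondPartition (class (proj₁ d)) j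

-- The quotient by the triangle relation (1, −1, 1).
φ : Vector ℤ 3 → Vector ℤ 2
φ x 0F = x 0F ℤ.+ x 1F
φ x 1F = x 1F ℤ.+ x 2F

section : Vector ℤ 2 → Vector ℤ 3
section y 0F = y 0F
section y 1F = 0ℤ
section y 2F = y 1F

φ-section : ∀ y → φ (section y) ≗ y
φ-section y 0F = ℤ.+-identityʳ (y 0F)
φ-section y 1F = ℤ.+-identityˡ (y 1F)

φ-cong : ∀ {x y} → x ≗ y → φ x ≗ φ y
φ-cong eq 0F = cong₂ ℤ._+_ (eq 0F) (eq 1F)
φ-cong eq 1F = cong₂ ℤ._+_ (eq 1F) (eq 2F)

φ-+ : ∀ x y k → φ (λ j → x j ℤ.+ y j) k ≡ φ x k ℤ.+ φ y k
φ-+ x y 0F = solve 4 (λ a b c d → (a :+ c) :+ (b :+ d) := (a :+ b) :+ (c :+ d)) refl (x 0F) (x 1F) (y 0F) (y 1F)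
φ-+ x y 1F = solve 4 (λ a b c d → (a :+ c) :+ (b :+ d) := (a :+ b) :+ (c :+ d)) refl (x 1F) (x 2F) (y 1F) (y 2F)

φ-neg : ∀ x k → φ (λ j → ℤ.- x j) k ≡ ℤ.- φ x k
φ-neg x 0F = sym (ℤ.neg-distrib-+ (x 0F) (x 1F))
φ-neg x 1F = sym (ℤ.neg-distrib-+ (x 1F) (x 2F))

φ-− : ∀ x y k → φ (λ j → x j ℤ.- y j) k ≡ φ x k ℤ.- φ y k
φ-− x y k = trans (φ-+ x (λ j → ℤ.- y j) k) (cong (ℤ._+_ (φ x k)) (φ-neg y k))

φ-0 : ∀ k → φ (λ _ → 0ℤ) k ≡ 0ℤ
φ-0 0F = refl
φ-0 1F = refl

φ-dart : ∀ d k → φ (signed d) k ≡ diamondLabels (target d) k ℤ.- diamondLabels (source d) k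
φ-dart = Dec.toWitness {a? = ∀-dart? λ d → Fin.all? λ k →
  φ (signed d) k ℤ.≟ diamondLabels (target d) k ℤ.- diamondLabels (source d) k} _

-- Label differences telescope along a walk; on a closed walk they cancel, so `φ` kills every row of
-- the cycle-class matrix.
φ-walk : ∀ {u v} (w : Walk u v) k →
         φ (crossings diamondPartition (darts w)) k ≡ diamondLabels v k ℤ.- diamondLabels u k
φ-walk {u} [] k = trans (φ-0 k) (sym (ℤ.+-inverseʳ (diamondLabels u k)))
φ-walk {v = v} (step d refl w) k = trans (φ-+ (signed d) _ k) (trans
  (cong₂ ℤ._+_ (φ-dart d k) (φ-walk w k))
  (solve 3 (λ s t v → (t :- s) :+ (v :- t) := v :- s) refl
    (diamondLabels (source d) k) (diamondLabels (target d) k) (diamondLabels v k)))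

-- The relations of the diamond for an arbitrary cycle basis

through : List Dart → Bool
through = List.foldr (λ d b → Dec.does (proj₁ d Fin.≟ # 4) ∨ b) false

-- Distinct sources exclude closed walks that traverse edge 4 and return along it; such a walk can
-- have net crossing 0.
Odd : List Dart → Set
Odd ds = Unique (List.map source ds) → through ds ≡ true →
  crossings diamondPartition ds 2F ≡ 1ℤ ⊎ crossings diamondPartition ds 2F ≡ -1ℤ

odd? : ∀ ds → Dec (Odd ds)
odd? ds = DecUnique.unique? Fin._≟_ (List.map source ds) →-dec
  ((through ds Bool.≟ true) →-dec ((_ ℤ.≟ 1ℤ) ⊎-dec (_ ℤ.≟ -1ℤ)))

abstract
  -- Decided by exhaustion. The incidence premises stand between the quantifiers, so only
  -- consecutive darts are pursued.
  triangles : ∀ d₀ d₁ → source d₁ ≡ target d₀ → ∀ d₂ → source d₂ ≡ target d₁ →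
              target d₂ ≡ source d₀ → Odd (d₀ ∷ d₁ ∷ d₂ ∷ [])
  triangles = Dec.toWitness {a? =
    ∀-dart? λ d₀ → ∀-dart? λ d₁ → (source d₁ Fin.≟ target d₀) →-dec
    ∀-dart? λ d₂ → (source d₂ Fin.≟ target d₁) →-dec
    ((target d₂ Fin.≟ source d₀) →-dec odd? (d₀ ∷ d₁ ∷ d₂ ∷ []))} _

  squares : ∀ d₀ d₁ → source d₁ ≡ target d₀ → ∀ d₂ → source d₂ ≡ target d₁ →
            ∀ d₃ → source d₃ ≡ target d₂ →
            target d₃ ≡ source d₀ → Odd (d₀ ∷ d₁ ∷ d₂ ∷ d₃ ∷ [])
  squares = Dec.toWitness {a? =
    ∀-dart? λ d₀ → ∀-dart? λ d₁ → (source d₁ Fin.≟ target d₀) →-dec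
    ∀-dart? λ d₂ → (source d₂ Fin.≟ target d₁) →-dec
    ∀-dart? λ d₃ → (source d₃ Fin.≟ target d₂) →-dec
    ((target d₃ Fin.≟ source d₀) →-dec odd? (d₀ ∷ d₁ ∷ d₂ ∷ d₃ ∷ []))} _

lookup-injective : ∀ {A : Set} {xs : List A} → Unique xs →
                   ∀ {i j} → List.lookup xs i ≡ List.lookup xs j → i ≡ j
lookup-injective (x∉ ∷ unique) {zero}  {zero}  eq = refl
lookup-injective (x∉ ∷ unique) {zero}  {suc j} eq = contradiction eq (All.lookup x∉ (Membership.∈-lookup j))
lookup-injective (x∉ ∷ unique) {suc i} {zero}  eq = contradiction (sym eq) (All.lookup x∉ (Membership.∈-lookup i))
lookup-injective (x∉ ∷ unique) {suc i} {suc j} eq = cong suc (lookup-injective unique eq)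

unique-length : ∀ {n} {xs : List (Fin n)} → Unique xs → List.length xs ≤ n
unique-length {xs = xs} unique = Fin.injective⇒≤ {f = List.lookup xs} (lookup-injective unique)

-- Edge 4 joins 1 and 2 and is the only edge of class 2; a cycle through it traverses it once.
cycle-odd : ∀ (Z : Cycle) → edgeSet Z (# 4) ≡ true →
  crossings diamondPartition (darts (Cycle.walk Z)) 2F ≡ 1ℤ ⊎
  crossings diamondPartition (darts (Cycle.walk Z)) 2F ≡ -1ℤ
cycle-odd Z = odd (Cycle.walk Z) (Cycle.length≥3 Z) (Cycle.unique Z)
  where
  odd : ∀ {u} (w : Walk u u) → 3 ≤ List.length (darts w) → Odd (darts w)
  odd (step d₀ p₀ (step d₁ p₁ (step d₂ p₂ []))) _ = triangles d₀ d₁ p₁ d₂ p₂ (sym p₀)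
  odd (step d₀ p₀ (step d₁ p₁ (step d₂ p₂ (step d₃ p₃ [])))) _ = squares d₀ d₁ p₁ d₂ p₂ d₃ p₃ (sym p₀)
  -- Five distinct sources do not fit among four vertices.
  odd (step _ _ (step _ _ (step _ _ (step _ _ (step _ _ _))))) _ unique with unique-length unique
  ... | s≤s (s≤s (s≤s (s≤s ())))
  odd (step _ _ []) (s≤s ())
  odd (step _ _ (step _ _ [])) (s≤s (s≤s ()))

⨁-true : ∀ {k} (b : Vector Bool k) → ⨁ b ≡ true → ∃ λ i → b i ≡ true
⨁-true {suc k} b eq with b zero in b₀
... | true  = zero , b₀
... | false with i , bᵢ ← ⨁-true (λ i → b (suc i)) eq = suc i , bᵢ

∧-trueʳ : ∀ {a b} → a ∧ b ≡ true → b ≡ true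
∧-trueʳ {true} eq = eq

triangle : EdgeSet
triangle = Vector.fromList (true ∷ false ∷ true ∷ false ∷ true ∷ [])

triangle∈cycleSpace : InCycleSpace triangle
triangle∈cycleSpace = Dec.toWitness {a? = Fin.all? λ v → _ Bool.≟ false} _

-- The triangle 0, 1, 2 is a sum of basis cycles and contains edge 4, so one of these cycles
-- contains edge 4.
odd-cycle : (B : CycleBasis) → ∃ λ i →
  cycleClassMatrix diamondPartition B i 2F ≡ 1ℤ ⊎ cycleClassMatrix diamondPartition B i 2F ≡ -1ℤ
odd-cycle B =
  let a , eq = CycleBasis.spanning B triangle triangle∈cycleSpace
      i , p  = ⨁-true (λ i → a i ∧ edgeSet (CycleBasis.cycles B i) (# 4)) (eq (# 4))
  in i , cycle-odd (CycleBasis.cycles B i) (∧-trueʳ {a i} p)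

kernel-multiple : ∀ {x} → (∀ k → φ x k ≡ 0ℤ) → x 0F ≡ x 2F × x 1F ≡ ℤ.- x 2F
kernel-multiple {x} eq =
  trans (solve 3 (λ a b c → a := (a :+ b) :- (b :+ c) :+ c) refl (x 0F) (x 1F) (x 2F))
        (trans (cong₂ (λ p q → p ℤ.- q ℤ.+ x 2F) (eq 0F) (eq 1F)) (ℤ.+-identityˡ (x 2F))) ,
  trans (solve 2 (λ b c → b := (b :+ c) :- c) refl (x 1F) (x 2F))
        (trans (cong (ℤ._- x 2F) (eq 1F)) (ℤ.+-identityˡ (ℤ.- x 2F)))

row-member : ∀ {t} (A : Matrix 2 t) i → Member (rowLattice A) (A i)
row-member A 0F = (1ℤ Vector.∷ 0ℤ Vector.∷ Vector.[]) , λ j →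
  solve 2 (λ x y → x := con 1ℤ :* x :+ (con 0ℤ :* y :+ con 0ℤ)) refl (A 0F j) (A 1F j)
row-member A 1F = (0ℤ Vector.∷ 1ℤ Vector.∷ Vector.[]) , λ j →
  solve 2 (λ x y → y := con 0ℤ :* x :+ (con 1ℤ :* y :+ con 0ℤ)) refl (A 0F j) (A 1F j)

module _ (B : CycleBasis) where
  private
    A : Matrix 2 3
    A = cycleClassMatrix diamondPartition B

    L : Subgroup (ℤ^ 3)
    L = rowLattice A

  φ-cycle : ∀ i k → φ (A i) k ≡ 0ℤ
  φ-cycle i k = trans (φ-walk (Cycle.walk (CycleBasis.cycles B i)) k)
                      (ℤ.+-inverseʳ (diamondLabels (Cycle.base (CycleBasis.cycles B i)) k))

  relations⊆kernel : ∀ {x} → Member L x → ∀ k → φ x k ≡ 0ℤ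
  relations⊆kernel {x} (a , eq) k = trans (φ-cong eq k) (vanish k)
    where
    expand : ∀ a b p q r s → (a ℤ.* p ℤ.+ (b ℤ.* q ℤ.+ 0ℤ)) ℤ.+ (a ℤ.* r ℤ.+ (b ℤ.* s ℤ.+ 0ℤ)) ≡
                             a ℤ.* (p ℤ.+ r) ℤ.+ b ℤ.* (q ℤ.+ s)
    expand = solve 6 (λ a b p q r s → (a :* p :+ (b :* q :+ con 0ℤ)) :+ (a :* r :+ (b :* s :+ con 0ℤ)) :=
                                      a :* (p :+ r) :+ b :* (q :+ s)) refl
    combine-zero : ∀ k → a 0F ℤ.* φ (A 0F) k ℤ.+ a 1F ℤ.* φ (A 1F) k ≡ 0ℤ
    combine-zero k = trans (cong₂ (λ p q → a 0F ℤ.* p ℤ.+ a 1F ℤ.* q) (φ-cycle 0F k) (φ-cycle 1F k))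
      (cong₂ ℤ._+_ (ℤ.*-zeroʳ (a 0F)) (ℤ.*-zeroʳ (a 1F)))
    vanish : ∀ k → φ (λ j → Σℤ (λ i → a i ℤ.* A i j)) k ≡ 0ℤ
    vanish 0F = trans (expand (a 0F) (a 1F) (A 0F 0F) (A 1F 0F) (A 0F 1F) (A 1F 1F)) (combine-zero 0F)
    vanish 1F = trans (expand (a 0F) (a 1F) (A 0F 1F) (A 1F 1F) (A 0F 2F) (A 1F 2F)) (combine-zero 1F)

  -- The row `A i` has third entry `s` = ±1 and lies in the kernel of `φ`, so it is `s` times (1,
  -- -1, 1). Since `s` squared is 1, `x` is the multiple of `A i` by `x 2F` times `s`.
  kernel⊆relations : ∀ {x} → (∀ k → φ x k ≡ 0ℤ) → Member L x
  kernel⊆relations {x} eq = Subgroup.resp L agree (·-closed L (x 2F ℤ.* s) (row-member A i))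
    where
    i = proj₁ (odd-cycle B)
    s = A i 2F
    s²≡1 : s ℤ.* s ≡ 1ℤ
    s²≡1 = Sum.[ (λ e → cong₂ ℤ._*_ e e) , (λ e → cong₂ ℤ._*_ e e) ]′ (proj₂ (odd-cycle B))
    xss : (x 2F ℤ.* s) ℤ.* s ≡ x 2F
    xss = trans (ℤ.*-assoc (x 2F) s s) (trans (cong (ℤ._*_ (x 2F)) s²≡1) (ℤ.*-identityʳ (x 2F)))
    x-multiple = kernel-multiple {x} eq
    A-multiple = kernel-multiple {A i} (φ-cycle i)
    agree : ∀ j → (x 2F ℤ.* s) ℤ.* A i j ≡ x j
    agree 0F = trans (cong (ℤ._*_ (x 2F ℤ.* s)) (proj₁ A-multiple)) (trans xss (sym (proj₁ x-multiple)))
    agree 1F = trans (cong (ℤ._*_ (x 2F ℤ.* s)) (proj₂ A-multiple))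
      (trans (sym (ℤ.neg-distribʳ-* (x 2F ℤ.* s) s)) (trans (cong ℤ.-_ xss) (sym (proj₂ x-multiple))))
    agree 2F = xss

splitting : (C : Choices diamond) → Splitting (Γuniv diamondPartition C) 2
splitting C = record
  { T       = trivialGroup
  ; finiteT = record
    { order       = 1
    ; enumeration = record
      { to        = λ _ → zero
      ; from      = λ _ → tt
      ; to-cong   = λ _ → refl
      ; from-cong = λ _ → tt
      ; inverse   = (λ { {zero} _ → refl }) , λ _ → tt
      }
    }
  ; split   = λ x → tt , φ x
  ; isIso   = record
    { isGroupMonomorphism = record
      { isGroupHomomorphism = record
        { isMonoidHomomorphism = record
          { isMagmaHomomorphism = record
            { isRelHomomorphism = record
              { cong = λ {x} {y} p → tt , λ k → ℤ.i-j≡0⇒i≡j (φ x k) (φ y k)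
                  (trans (sym (φ-− x y k)) (relations⊆kernel B p k)) }
            ; homo = λ x y → tt , φ-+ x y
            }
          ; ε-homo = tt , φ-0
          }
        ; ⁻¹-homo = λ x → tt , φ-neg x
        }
      ; injective = λ {x} {y} (_ , eq) → kernel⊆relations B λ k →
          trans (φ-− x y k) (ℤ.i≡j⇒i-j≡0 {φ x k} {φ y k} (eq k))
      }
    ; surjective = λ (_ , y) → section y , λ {z} p → tt , λ k → trans
        (ℤ.i-j≡0⇒i≡j (φ z k) (φ (section y) k) (trans (sym (φ-− z (section y) k)) (relations⊆kernel B p k)))
        (φ-section y k)
    }
  }
  where B = Choices.basis C

-- Isometry of a quotient as avoidance of forbidden vectors

infixl 6 _⊖_ _⊕_
_⊕_ _⊖_ : ∀ {k} → Vector ℤ k → Vector ℤ k → Vector ℤ k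
(x ⊕ y) i = x i ℤ.+ y i
(x ⊖ y) i = x i ℤ.- y i

_≗?_ : ∀ {k} (x y : Vector ℤ k) → Dec (x ≗ y)
x ≗? y = Fin.all? λ i → x i ℤ.≟ y i

-- The differences of two distinct labels, and those of the labels of 3 and 0
-- modified by one generator, up to sign.
forbidden : Fin 8 → Vector ℤ 2
forbidden = Vector.fromList
  ( pair (+ 1) (+ 0) ∷ pair (+ 0) (+ 1) ∷ pair (+ 1) (+ 1) ∷ pair (+ 2) (+ 1)
  ∷ pair (+ 3) (+ 1) ∷ pair (+ 3) (+ 2) ∷ pair (+ 2) (+ 0) ∷ pair (+ 2) (+ 2) ∷ [])

Forbidden : Vector ℤ 2 → Set
Forbidden y = ∃ λ k → y ≗ forbidden k ⊎ (λ i → ℤ.- y i) ≗ forbidden k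

forbidden? : ∀ y → Dec (Forbidden y)
forbidden? y = Fin.any? λ k → (y ≗? forbidden k) ⊎-dec ((λ i → ℤ.- y i) ≗? forbidden k)

Forbidden-resp : ∀ {x y} → x ≗ y → Forbidden x → Forbidden y
Forbidden-resp eq (k , inj₁ p) = k , inj₁ λ i → trans (sym (eq i)) (p i)
Forbidden-resp eq (k , inj₂ p) = k , inj₂ λ i → trans (cong ℤ.-_ (sym (eq i))) (p i)

dist : Fin 4 → Fin 4 → ℕ
dist u v = if Dec.does (u Fin.≟ v) then 0
           else if Dec.does (far? u v) then 2 else 1
  where
  far? : ∀ u v → Dec ((u ≡ # 0 × v ≡ # 3) ⊎ (u ≡ # 3 × v ≡ # 0))
  far? u v = ((u Fin.≟ # 0) ×-dec (v Fin.≟ # 3)) ⊎-dec ((u Fin.≟ # 3) ×-dec (v Fin.≟ # 0))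

abstract
  diamond-dist : ∀ u v → UGraph.IsDistance ugraph u v (dist u v)
  diamond-dist u v = to (GraphSearch.bfs⇔distance diamond u) (searched u v)
    where
    searched : ∀ u v → bfsᴳ u v ≡ just (dist u v)
    searched = Dec.toWitness {a? = Fin.all? λ u → Fin.all? λ v →
      Maybe.≡-dec ℕ._≟_ (bfsᴳ u v) (just (dist u v))} _

  distinct-forbidden : ∀ u v → u ≢ v → Forbidden (diamondLabels u ⊖ diamondLabels v)
  distinct-forbidden = Dec.toWitness {a? = Fin.all? λ u → Fin.all? λ v →
    ¬? (u Fin.≟ v) →-dec forbidden? (diamondLabels u ⊖ diamondLabels v)} _

  far-forbidden : ∀ u v j → dist u v ≡ 2 →
    Forbidden (diamondLabels v ⊖ diamondLabels u ⊖ diamondGenerators j) ×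
    Forbidden (diamondLabels v ⊖ diamondLabels u ⊕ diamondGenerators j)
  far-forbidden = Dec.toWitness {a? = Fin.all? λ u → Fin.all? λ v → Fin.all? λ j →
    (dist u v ℕ.≟ 2) →-dec
    (forbidden? (diamondLabels v ⊖ diamondLabels u ⊖ diamondGenerators j) ×-dec
     forbidden? (diamondLabels v ⊖ diamondLabels u ⊕ diamondGenerators j))} _

  dist-cases : ∀ u v → dist u v ≡ 0 ⊎ (u ≢ v × (dist u v ≡ 1 ⊎ dist u v ≡ 2))
  dist-cases = Dec.toWitness {a? = Fin.all? λ u → Fin.all? λ v →
    (dist u v ℕ.≟ 0) ⊎-dec (¬? (u Fin.≟ v) ×-dec ((dist u v ℕ.≟ 1) ⊎-dec (dist u v ℕ.≟ 2)))} _

  -- Traces each listed vector back to the identification or the shortcut that it would cause; this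
  -- makes avoidance necessary, while `distinct-forbidden` and `far-forbidden` make it sufficient.
  forbidden-source : ∀ k →
    (∃ λ u → ∃ λ v → u ≢ v × forbidden k ≗ (diamondLabels u ⊖ diamondLabels v)) ⊎
    (∃ λ j → forbidden k ≗ (diamondLabels (# 3) ⊖ diamondLabels (# 0) ⊖ diamondGenerators j) ⊎
             forbidden k ≗ (diamondLabels (# 3) ⊖ diamondLabels (# 0) ⊕ diamondGenerators j))
  forbidden-source = Dec.toWitness {a? = Fin.all? λ k →
    (Fin.any? λ u → Fin.any? λ v → ¬? (u Fin.≟ v) ×-dec (forbidden k ≗? (diamondLabels u ⊖ diamondLabels v)))
    ⊎-dec
    (Fin.any? λ j → (forbidden k ≗? (diamondLabels (# 3) ⊖ diamondLabels (# 0) ⊖ diamondGenerators j)) ⊎-dec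
                    (forbidden k ≗? (diamondLabels (# 3) ⊖ diamondLabels (# 0) ⊕ diamondGenerators j)))} _

φ-unit : ∀ j → φ (unit diamondPartition j) ≗ diamondGenerators j
φ-unit = Dec.toWitness {a? = Fin.all? λ j → φ (unit diamondPartition j) ≗? diamondGenerators j} _

module _ (C : Choices diamond) (root≡0 : Choices.root C ≡ zero) where

  private
    B = Choices.basis C
    ℓ : Fin 4 → Vector ℤ 3
    ℓ = label diamondPartition C

  φ-label : ∀ v → φ (ℓ v) ≗ diamondLabels v
  φ-label v k = trans (φ-walk (Path.walk (Choices.paths C v)) k) (trans
    (cong (λ r → diamondLabels v k ℤ.- diamondLabels r k) root≡0)
    (trans (cong (ℤ._-_ (diamondLabels v k)) (origin k)) (ℤ.+-identityʳ (diamondLabels v k))))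
    where
    origin : ∀ k → diamondLabels zero k ≡ 0ℤ
    origin 0F = refl
    origin 1F = refl

  module _ (R : FiniteQuotient (Γuniv diamondPartition C)) where
    open FiniteQuotient R
    open Quotient R
    open Hosts diamondPartition C
    private
      H = host diamondPartition C R
      module W = UGraph H
      module D = UGraph ugraph

    Avoids : Set
    Avoids = ∀ x → Forbidden (φ x) → ¬ InKernel x

    φ-injective : ∀ {x y} → φ x ≗ φ y → π x Q.≈ π y
    φ-injective {x} {y} eq = π.⟦⟧-cong (kernel⊆relations B λ k →
      trans (φ-− x y k) (ℤ.i≡j⇒i-j≡0 {φ x k} {φ y k} (eq k)))

    avoids-≈ : Avoids → ∀ {x y} → Forbidden (φ x ⊖ φ y) → ¬ π x Q.≈ π y
    avoids-≈ avoids {x} {y} forb eq = avoids (x ⊖ y)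
      (Forbidden-resp (λ k → sym (φ-− x y k)) forb) (from (kernel⇔ {x} {y}) eq)

    label-generator : ∀ u v j → π (ℓ v) Q.≈ π (ℓ u) Q.∙ generator/ diamondPartition C R j →
                      π (ℓ v) Q.≈ π (ℓ u ⊕ unit diamondPartition j)
    label-generator u v j eq = Q.trans eq (Q.sym (π.homo (ℓ u) (unit diamondPartition j)))

    label-generator⁻¹ : ∀ u v j → π (ℓ v) Q.≈ π (ℓ u) Q.∙ generator/ diamondPartition C R j Q.⁻¹ →
                        π (ℓ v) Q.≈ π (ℓ u ⊖ unit diamondPartition j)
    label-generator⁻¹ u v j eq = Q.trans eq (Q.sym (π-quotient (ℓ u) (unit diamondPartition j)))

    module _ (avoids : Avoids) where

      labels-distinct : ∀ u v → u ≢ v → ¬ π (ℓ u) Q.≈ π (ℓ v)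
      labels-distinct u v u≢v = avoids-≈ avoids (Forbidden-resp
        (λ k → sym (cong₂ ℤ._-_ (φ-label u k) (φ-label v k))) (distinct-forbidden u v u≢v))

      far-labels : ∀ u v → dist u v ≡ 2 → ¬ W.WalkOfLength 1 (π (ℓ u)) (π (ℓ v))
      far-labels u v far (UGraph.step (s , (_ , j , eq) , w≈) (UGraph.stop w≈v)) = excluded eq
        where
        v≈us : π (ℓ v) Q.≈ π (ℓ u) Q.∙ s
        v≈us = Q.trans (Q.sym w≈v) w≈
        excluded : ¬ (s Q.≈ generator/ diamondPartition C R j ⊎ s Q.≈ generator/ diamondPartition C R j Q.⁻¹)
        excluded (inj₁ eq) = avoids-≈ avoids (Forbidden-resp
          (λ k → trans
            (cong₂ ℤ._-_ (cong₂ ℤ._-_ (sym (φ-label v k)) (sym (φ-label u k))) (sym (φ-unit j k)))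
            (trans (solve 3 (λ v u g → v :- u :- g := v :- (u :+ g)) refl
                     (φ (ℓ v) k) (φ (ℓ u) k) (φ (unit diamondPartition j) k))
                   (cong (ℤ._-_ (φ (ℓ v) k)) (sym (φ-+ (ℓ u) (unit diamondPartition j) k)))))
          (proj₁ (far-forbidden u v j far)))
          (label-generator u v j (Q.trans v≈us (Q.∙-congˡ eq)))
        excluded (inj₂ eq) = avoids-≈ avoids (Forbidden-resp
          (λ k → trans
            (cong₂ ℤ._+_ (cong₂ ℤ._-_ (sym (φ-label v k)) (sym (φ-label u k))) (sym (φ-unit j k)))
            (trans (solve 3 (λ v u g → v :- u :+ g := v :- (u :- g)) refl
                     (φ (ℓ v) k) (φ (ℓ u) k) (φ (unit diamondPartition j) k))
                   (cong (ℤ._-_ (φ (ℓ v) k)) (sym (φ-− (ℓ u) (unit diamondPartition j) k)))))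
          (proj₂ (far-forbidden u v j far)))
          (label-generator⁻¹ u v j (Q.trans v≈us (Q.∙-congˡ eq)))

      -- With diameter 2, a walk that is too short either has length 0 between distinct labels or
      -- joins the labels of 0 and 3 in one step; the two kinds of forbidden vectors exclude both.
      dist-minimal : ∀ u v {k} → W.WalkOfLength k (π (ℓ u)) (π (ℓ v)) → dist u v ≤ k
      dist-minimal u v w with dist-cases u v
      ... | inj₁ d≡0 = subst (_≤ _) (sym d≡0) z≤n
      dist-minimal u v (UGraph.stop eq) | inj₂ (u≢v , _) = contradiction eq (labels-distinct u v u≢v)
      dist-minimal u v (UGraph.step _ _) | inj₂ (_ , inj₁ d≡1) = subst (_≤ _) (sym d≡1) (s≤s z≤n)
      dist-minimal u v w@(UGraph.step _ (UGraph.stop _)) | inj₂ (_ , inj₂ d≡2) =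
        contradiction w (far-labels u v d≡2)
      dist-minimal u v (UGraph.step _ (UGraph.step _ _)) | inj₂ (_ , inj₂ d≡2) =
        subst (_≤ _) (sym d≡2) (s≤s (s≤s z≤n))

      -- An edge could be lost only if its generator became trivial, and then its two end labels
      -- would coincide.
      dart-step : ∀ d → W.Adj (π (ℓ (source d))) (π (ℓ (target d)))
      dart-step d = π (signed d) , (nonzero , class (proj₁ d) , generated (isForward d) refl) , moves
        where
        moves : π (ℓ (target d)) Q.≈ π (ℓ (source d)) Q.∙ π (signed d)
        moves = Q.trans (φ-injective λ k → trans (φ-label (target d) k) (sym (trans
            (φ-+ (ℓ (source d)) (signed d) k) (trans (cong₂ ℤ._+_ (φ-label (source d) k) (φ-dart d k))
            (solve 2 (λ s t → s :+ (t :- s) := t) refl (diamondLabels (source d) k) (diamondLabels (target d) k))))))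
          (π.homo (ℓ (source d)) (signed d))
        ends-differ : ∀ d → target d ≢ source d
        ends-differ (e , true)  eq = loopless e (sym eq)
        ends-differ (e , false) eq = loopless e eq
        nonzero : ¬ π (signed d) Q.≈ Q.ε
        nonzero eq = labels-distinct (target d) (source d) (ends-differ d)
          (Q.trans moves (Q.trans (Q.∙-congˡ eq) (Q.identityʳ _)))
        generated : ∀ b → isForward d ≡ b →
          π (signed d) Q.≈ generator/ diamondPartition C R (class (proj₁ d)) ⊎
          π (signed d) Q.≈ generator/ diamondPartition C R (class (proj₁ d)) Q.⁻¹
        generated true  eq rewrite eq = inj₁ Q.refl
        generated false eq rewrite eq = inj₂ (π.⁻¹-homo (unit diamondPartition (class (proj₁ d))))

      walk-embed : ∀ {k u v} → D.WalkOfLength k u v → W.WalkOfLength k (π (ℓ u)) (π (ℓ v))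
      walk-embed (UGraph.stop refl) = UGraph.stop Q.refl
      walk-embed (UGraph.step (d , refl , refl) w) = UGraph.step (dart-step d) (walk-embed w)

      avoids⇒isometric : Isometric diamondPartition C R
      avoids⇒isometric = Search.preserving⇒isometric R λ u v k → mk⇔
        (λ d → subst (W.IsDistance (π (ℓ u)) (π (ℓ v)))
          (Walks.distance-unique ugraph (diamond-dist u v) d) (embedded u v))
        (λ d → subst (D.IsDistance u v)
          (Walks.distance-unique H (embedded u v) d) (diamond-dist u v))
        where
        embedded : ∀ u v → W.IsDistance (π (ℓ u)) (π (ℓ v)) (dist u v)
        embedded u v = walk-embed (proj₁ (diamond-dist u v)) , dist-minimal u v

    isometric⇒avoids : Isometric diamondPartition C R → Avoids
    isometric⇒avoids iso = λ where
        x (k , inj₁ eq) → listed x k eq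
        x (k , inj₂ eq) p → listed (λ j → ℤ.- x j) k (λ i → trans (φ-neg x i) (eq i))
          (Q.trans (π.⁻¹-homo x) (Q.trans (Q.⁻¹-cong p) (AbelianGroupProperties.ε⁻¹≈ε group)))
      where
      -- A nonzero `s` would give a walk of length 1 where the distance is 2; a trivial `s` would
      -- identify the labels of 3 and 0.
      not-adjacent : ∀ j {s} →
                     s Q.≈ generator/ diamondPartition C R j ⊎ s Q.≈ generator/ diamondPartition C R j Q.⁻¹ →
                     ¬ π (ℓ (# 3)) Q.≈ π (ℓ (# 0)) Q.∙ s
      not-adjacent j {s} gen eq = ℕ.<⇒≱ {1} {2} (s≤s (s≤s z≤n))
        (proj₂ (to (Isometric.preserving iso (# 0) (# 3) 2) (diamond-dist (# 0) (# 3)))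
          (UGraph.step (s , (nonzero , j , gen) , eq) (UGraph.stop Q.refl)))
        where
        nonzero : ¬ s Q.≈ Q.ε
        nonzero s≈ε with Isometric.injective iso (# 3) (# 0)
                           (Q.trans eq (Q.trans (Q.∙-congˡ s≈ε) (Q.identityʳ _)))
        ... | ()

      difference : ∀ {x} y → φ x ≗ φ y → InKernel x → InKernel y
      difference {x} y eq p = Q.trans (φ-injective {y} {x} (λ k → sym (eq k))) p

      listed : ∀ x k → φ x ≗ forbidden k → ¬ InKernel x
      listed x k eq p = refute (forbidden-source k)
        where
        refute : (∃ λ u → ∃ λ v → u ≢ v × forbidden k ≗ (diamondLabels u ⊖ diamondLabels v)) ⊎
                 (∃ λ j → forbidden k ≗ (diamondLabels (# 3) ⊖ diamondLabels (# 0) ⊖ diamondGenerators j) ⊎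
                          forbidden k ≗ (diamondLabels (# 3) ⊖ diamondLabels (# 0) ⊕ diamondGenerators j)) → ⊥
        refute (inj₁ (u , v , u≢v , src)) = u≢v (Isometric.injective iso u v (to (kernel⇔ {ℓ u} {ℓ v})
          (difference (ℓ u ⊖ ℓ v) (λ i → trans (eq i) (trans (src i)
            (sym (trans (φ-− (ℓ u) (ℓ v) i) (cong₂ ℤ._-_ (φ-label u i) (φ-label v i)))))) p)))
        refute (inj₂ (j , inj₁ src)) = not-adjacent j (inj₁ Q.refl) (Q.trans (to (kernel⇔ {ℓ (# 3)} {ℓ (# 0) ⊕ g})
          (difference (ℓ (# 3) ⊖ (ℓ (# 0) ⊕ g)) (λ i → trans (eq i) (trans (src i)
            (sym (trans (trans (φ-− (ℓ (# 3)) (ℓ (# 0) ⊕ g) i) (cong (ℤ._-_ (φ (ℓ (# 3)) i)) (φ-+ (ℓ (# 0)) g i)))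
              (trans (cong₂ ℤ._-_ (φ-label (# 3) i) (cong₂ ℤ._+_ (φ-label (# 0) i) (φ-unit j i)))
                (solve 3 (λ v u g → v :- (u :+ g) := v :- u :- g) refl
                  (diamondLabels (# 3) i) (diamondLabels (# 0) i) (diamondGenerators j i))))))) p))
          (π.homo (ℓ (# 0)) g))
          where g = unit diamondPartition j
        refute (inj₂ (j , inj₂ src)) = not-adjacent j (inj₂ Q.refl) (Q.trans (to (kernel⇔ {ℓ (# 3)} {ℓ (# 0) ⊖ g})
          (difference (ℓ (# 3) ⊖ (ℓ (# 0) ⊖ g)) (λ i → trans (eq i) (trans (src i)
            (sym (trans (trans (φ-− (ℓ (# 3)) (ℓ (# 0) ⊖ g) i) (cong (ℤ._-_ (φ (ℓ (# 3)) i)) (φ-− (ℓ (# 0)) g i)))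
              (trans (cong₂ ℤ._-_ (φ-label (# 3) i) (cong₂ ℤ._-_ (φ-label (# 0) i) (φ-unit j i)))
                (solve 3 (λ v u g → v :- (u :- g) := v :- u :+ g) refl
                  (diamondLabels (# 3) i) (diamondLabels (# 0) i) (diamondGenerators j i))))))) p))
          (π-quotient (ℓ (# 0)) g))
          where g = unit diamondPartition j

    -- Six points whose pairwise differences are forbidden.
    private
      point : Fin 6 → Vector ℤ 2
      point = Vector.fromList
        ( pair (+ 0) (+ 0) ∷ pair (+ 1) (+ 0) ∷ pair (+ 1) (+ 1) ∷ pair (+ 2) (+ 1)
        ∷ pair -1ℤ (+ 0) ∷ pair -1ℤ -1ℤ ∷ [])

    6≤order : Isometric diamondPartition C R → 6 ≤ order
    6≤order iso = Fin.injective⇒≤ {f = λ i → Finite.to finite (π (section (point i)))} injective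
      where
      separated : ∀ i j → i ≢ j → Forbidden (point i ⊖ point j)
      separated = Dec.toWitness {a? = Fin.all? λ i → Fin.all? λ j →
        ¬? (i Fin.≟ j) →-dec forbidden? (point i ⊖ point j)} _

      injective : ∀ {i j} → Finite.to finite (π (section (point i))) ≡
                            Finite.to finite (π (section (point j))) → i ≡ j
      injective {i} {j} eq = Dec.decidable-stable (i Fin.≟ j) λ i≢j →
        contradiction (FiniteSetoid.number-injective finite eq)
          (avoids-≈ (isometric⇒avoids iso) {section (point i)} {section (point j)} (Forbidden-resp
          (λ k → cong₂ ℤ._-_ (sym (φ-section (point i) k)) (sym (φ-section (point j) k)))
          (separated i j i≢j)))

diamond-connected : Graph.Connected diamond
diamond-connected u v = walk (proj₁ (diamond-dist u v))
  where
  walk : ∀ {k u v} → UGraph.WalkOfLength ugraph k u v → Walk u v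
  walk (UGraph.stop refl)          = []
  walk (UGraph.step (d , p , refl) w) = step d p (walk w)

-- Folds by sublattices of ℤ^2

AvoidsForbidden : Subgroup (ℤ^ 2) → Set
AvoidsForbidden L = ∀ y → Forbidden y → ¬ Member L y

module _ (C : Choices diamond) (root≡0 : Choices.root C ≡ zero) (L : FiniteIndexSublattice 2) where
  fold-avoids : Avoids C root≡0 (fold (splitting C) L) ⇔ AvoidsForbidden (lattice L)
  fold-avoids = mk⇔
    (λ avoids y forb p → avoids (section y) (Forbidden-resp (λ k → sym (φ-section y k)) forb)
      (from (Splits.fold-kernel (splitting C) L (section y))
        (tt , Subgroup.resp (lattice L) (λ k → sym (φ-section y k)) p)))
    (λ avoids x forb p → avoids (φ x) forb (proj₂ (to (Splits.fold-kernel (splitting C) L x) p)))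

  isometric⇔avoids : Isometric diamondPartition C (fold (splitting C) L) ⇔ AvoidsForbidden (lattice L)
  isometric⇔avoids = mk⇔
    (λ iso → to fold-avoids (isometric⇒avoids C root≡0 (fold (splitting C) L) iso))
    (λ avoids → avoids⇒isometric C root≡0 (fold (splitting C) L) (from fold-avoids avoids))

  passes⇔avoids : Passes diamondPartition C (splitting C) L ⇔ AvoidsForbidden (lattice L)
  passes⇔avoids = mk⇔
    (λ passes → to isometric⇔avoids
      (Hosts.Search.exact⇒isometric diamondPartition C (fold (splitting C) L) diamond-connected passes))
    (λ avoids → Hosts.Search.isometric⇒exact diamondPartition C (fold (splitting C) L) diamond-connected
      (from isometric⇔avoids avoids))

-- A form of `a ≤ N` that also admits `N` = 0, where congruence is equality; `IsDiagonal` by itself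
-- allows this value.
Indivisible-below : ℕ → ℕ → Set
Indivisible-below N a = ∀ k → 0 < k → k < a → ¬ N ℕ.∣ k

difference-zero : ∀ {N a} → Indivisible-below N a → ∀ {i j} → i < a → j < a →
                  (+ N) ℤ.∣ (+ i ℤ.- + j) → i ≡ j
difference-zero {N} {a} indivisible {i} {j} i<a j<a N∣ = ℤ.+-injective (ℤ.i-j≡0⇒i≡j (+ i) (+ j) (ℤ.∣i∣≡0⇒i≡0
  (Dec.decidable-stable (_ ℕ.≟ 0) λ ≢0 → indivisible _ (ℕ.n≢0⇒n>0 ≢0) bound N∣)))
  where
  bound : ∣ + i ℤ.- + j ∣ < a
  bound = subst (λ z → ∣ z ∣ < a) (sym (ℤ.m-n≡m⊖n i j))
    (ℕ.≤-<-trans (ℤ.∣m⊝n∣≤m⊔n i j) (ℕ.⊔-lub i<a j<a))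

-- The points of an a × b box are pairwise incongruent modulo L.
box≤index : (L : FiniteIndexSublattice 2) (D : IsDiagonal L) → ∀ a b →
  Indivisible-below (proj₁ D 0F) a → Indivisible-below (proj₁ D 1F) b → a ℕ.* b ≤ index L
box≤index L (N , diagonal) a b aᴺ bᴺ =
  Fin.injective⇒≤ {f = λ k → Finite.to (FiniteIndexSublattice.finite L) (corner k)} injective
  where
  module F = FiniteSetoid (FiniteIndexSublattice.finite L)
  i : Fin (a ℕ.* b) → Fin a
  i k = proj₁ (Fin.remQuot {a} b k)
  j : Fin (a ℕ.* b) → Fin b
  j k = proj₂ (Fin.remQuot {a} b k)
  corner : Fin (a ℕ.* b) → Vector ℤ 2
  corner k = pair (+ toℕ (i k)) (+ toℕ (j k))
  injective : ∀ {k l} → Finite.to (FiniteIndexSublattice.finite L) (corner k) ≡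
                        Finite.to (FiniteIndexSublattice.finite L) (corner l) → k ≡ l
  injective {k} {l} eq = trans (sym (Fin.combine-remQuot {a} b k)) (trans
    (cong₂ Fin.combine
      (Fin.toℕ-injective (difference-zero aᴺ (Fin.toℕ<n (i k)) (Fin.toℕ<n (i l)) (divides 0F)))
      (Fin.toℕ-injective (difference-zero bᴺ (Fin.toℕ<n (j k)) (Fin.toℕ<n (j l)) (divides 1F))))
    (Fin.combine-remQuot {a} b l))
    where
    divides : ∀ m → (+ N m) ℤ.∣ (corner k m ℤ.- corner l m)
    divides = to (diagonal _) (F.number-injective {corner k} {corner l} eq)

-- Avoiding (1,0) and (2,0) means that `N 0F` divides neither 1 nor 2, avoiding (0,1) that `N 1F`
-- does not divide 1, and avoiding (3,2) that `N 0F` does not divide 3 or `N 1F` does not divide 2.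
-- So a 4 by 2 or a 3 by 3 box fits, and neither 8 nor 9 is at most 6.
diagonal-fails : (L : FiniteIndexSublattice 2) → IsDiagonal L → index L ≡ 6 → ¬ AvoidsForbidden (lattice L)
diagonal-fails L D@(N , diagonal) index≡6 avoids = split (N 0F ℕ.∣? 3) (N 1F ℕ.∣? 2)
  where
  excluded : ∀ k → ¬ (N 0F ℕ.∣ ∣ forbidden k 0F ∣ × N 1F ℕ.∣ ∣ forbidden k 1F ∣)
  excluded k (p , q) = avoids (forbidden k) (k , inj₁ λ _ → refl) (from (diagonal _) λ { 0F → p ; 1F → q })

  N₀∤1 : ¬ N 0F ℕ.∣ 1
  N₀∤1 p = excluded (# 0) (p , N 1F ℕ.∣0)

  N₀∤2 : ¬ N 0F ℕ.∣ 2
  N₀∤2 p = excluded (# 6) (p , N 1F ℕ.∣0)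

  N₁∤1 : ¬ N 1F ℕ.∣ 1
  N₁∤1 p = excluded (# 1) (N 0F ℕ.∣0 , p)

  tooLarge : ∀ {m} → 7 ≤ m → ¬ m ≤ index L
  tooLarge 7≤m m≤ = ℕ.<⇒≱ 7≤m (ℕ.≤-trans m≤ (ℕ.≤-reflexive index≡6))

  split : Dec (N 0F ℕ.∣ 3) → Dec (N 1F ℕ.∣ 2) → ⊥
  split (yes p) (yes q) = excluded (# 5) (p , q)
  split (no N₀∤3) _ = tooLarge {8} (Dec.toWitness {a? = 7 ℕ.≤? 8} _) (box≤index L D 4 2
    (λ { 1 _ _ → N₀∤1 ; 2 _ _ → N₀∤2 ; 3 _ _ → N₀∤3
       ; (suc (suc (suc (suc _)))) _ (s≤s (s≤s (s≤s (s≤s ())))) })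
    (λ { 1 _ _ → N₁∤1 ; (suc (suc _)) _ (s≤s (s≤s ())) }))
  split (yes _) (no N₁∤2) = tooLarge {9} (Dec.toWitness {a? = 7 ℕ.≤? 9} _) (box≤index L D 3 3
    (λ { 1 _ _ → N₀∤1 ; 2 _ _ → N₀∤2 ; (suc (suc (suc _))) _ (s≤s (s≤s (s≤s ()))) })
    (λ { 1 _ _ → N₁∤1 ; 2 _ _ → N₁∤2 ; (suc (suc (suc _))) _ (s≤s (s≤s (s≤s ()))) }))

-- The non-diagonal lattice of index 6

hermiteBasis : HNFBasis 2
hermiteBasis = M , Dec.toWitness {a? = isHNF? M} _
  where
  M : Matrix 2 2
  -- Row reduction of `optimalBasis`: (0,6) is 3(1,2) - (3,0).
  M = pair (pair (+ 1) (+ 2)) (pair (+ 0) (+ 6))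

-- It kills (1,2), sends (0,1) to 1 and (0,6) to 6, so modulo 6 it identifies the quotient by the
-- lattice with ℤ/6.
ζ : Vector ℤ 2 → ℤ
ζ y = y 1F ℤ.- + 2 ℤ.* y 0F

hermite-member : ∀ y → Member (lattice ⟨ hermiteBasis ⟩) y ⇔ (+ 6) Signed.∣ ζ y
hermite-member y = mk⇔
  (λ (a , p) → Signed.divides (a 1F) (trans (cong₂ (λ u v → u ℤ.- + 2 ℤ.* v) (p 1F) (p 0F))
    (solve 2 (λ a b → (a :* con (+ 2) :+ (b :* con (+ 6) :+ con 0ℤ)) :-
                      con (+ 2) :* (a :* con (+ 1) :+ (b :* con 0ℤ :+ con 0ℤ))
                    := b :* con (+ 6)) refl (a 0F) (a 1F))))
  (λ { (Signed.divides q eq) → pair (y 0F) q , λ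
    { 0F → solve 2 (λ y q → y := y :* con (+ 1) :+ (q :* con 0ℤ :+ con 0ℤ)) refl (y 0F) q
    ; 1F → trans (solve 2 (λ y x → x := y :* con (+ 2) :+ ((x :- con (+ 2) :* y) :+ con 0ℤ)) refl (y 0F) (y 1F))
                 (cong (λ z → y 0F ℤ.* + 2 ℤ.+ (z ℤ.+ 0ℤ)) eq) } })

hermite≐optimal : lattice ⟨ hermiteBasis ⟩ ≐ rowLattice optimalBasis
hermite≐optimal y = mk⇔
  (λ (a , p) → pair (ℤ.- a 1F) (a 0F ℤ.+ + 3 ℤ.* a 1F) , λ
    { 0F → trans (p 0F) (solve 2 (λ a b → a :* con (+ 1) :+ (b :* con 0ℤ :+ con 0ℤ) :=
             (:- b) :* con (+ 3) :+ ((a :+ con (+ 3) :* b) :* con (+ 1) :+ con 0ℤ)) refl (a 0F) (a 1F))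
    ; 1F → trans (p 1F) (solve 2 (λ a b → a :* con (+ 2) :+ (b :* con (+ 6) :+ con 0ℤ) :=
             (:- b) :* con 0ℤ :+ ((a :+ con (+ 3) :* b) :* con (+ 2) :+ con 0ℤ)) refl (a 0F) (a 1F)) })
  (λ (a , p) → pair (+ 3 ℤ.* a 0F ℤ.+ a 1F) (ℤ.- a 0F) , λ
    { 0F → trans (p 0F) (solve 2 (λ a b → a :* con (+ 3) :+ (b :* con (+ 1) :+ con 0ℤ) :=
             (con (+ 3) :* a :+ b) :* con (+ 1) :+ ((:- a) :* con 0ℤ :+ con 0ℤ)) refl (a 0F) (a 1F))
    ; 1F → trans (p 1F) (solve 2 (λ a b → a :* con 0ℤ :+ (b :* con (+ 2) :+ con 0ℤ) :=
             (con (+ 3) :* a :+ b) :* con (+ 2) :+ ((:- a) :* con (+ 6) :+ con 0ℤ)) refl (a 0F) (a 1F)) })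

ζ-neg : ∀ y → ζ (λ i → ℤ.- y i) ≡ ℤ.- ζ y
ζ-neg y = solve 2 (λ a b → :- b :- con (+ 2) :* (:- a) := :- (b :- con (+ 2) :* a)) refl (y 0F) (y 1F)

ζ-cong : ∀ {x y} → x ≗ y → ζ x ≡ ζ y
ζ-cong eq = cong₂ (λ u v → u ℤ.- + 2 ℤ.* v) (eq 1F) (eq 0F)

hermite-avoids : AvoidsForbidden (lattice ⟨ hermiteBasis ⟩)
hermite-avoids y forb p = contradict forb (to (hermite-member y) p)
  where
  indivisible : ∀ k → ¬ (+ 6) Signed.∣ ζ (forbidden k)
  indivisible = Dec.toWitness {a? = Fin.all? λ k → ¬? (+ 6 Signed.∣? ζ (forbidden k))} _
  contradict : Forbidden y → ¬ (+ 6) Signed.∣ ζ y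
  contradict (k , inj₁ eq) d = indivisible k (subst (+ 6 Signed.∣_) (ζ-cong eq) d)
  contradict (k , inj₂ eq) d = indivisible k
    (subst (+ 6 Signed.∣_) (trans (sym (ζ-neg y)) (ζ-cong eq)) (Signed.∣m⇒∣-m d))

-- Since (1,2) is in the lattice, a diagonal form would have first modulus 1 and contain (1,0),
-- whose `ζ` is -2.
hermite-not-diagonal : ¬ IsDiagonal ⟨ hermiteBasis ⟩
hermite-not-diagonal (N , diagonal) = absurd
  (to (hermite-member e₀) (from (diagonal e₀) λ { 0F → first 0F ; 1F → N 1F ℕ.∣0 }))
  where
  e₀ : Vector ℤ 2
  e₀ = pair (+ 1) 0ℤ
  first : ∀ i → (+ N i) ℤ.∣ pair (+ 1) (+ 2) i
  first = to (diagonal (pair (+ 1) (+ 2))) (from (hermite-member (pair (+ 1) (+ 2))) (Signed.divides 0ℤ refl))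
  absurd : ¬ (+ 6) Signed.∣ ζ e₀
  absurd = Dec.toWitness {a? = ¬? (+ 6 Signed.∣? ζ e₀)} _

-- The octahedral host

private module O = AbelianGroup ℤ₂×ℤ₃

module _ (C : Choices diamond) where
  private
    Q = fold (splitting C) ⟨ hermiteBasis ⟩
    module Q = AbelianGroup (FiniteQuotient.group Q)

  -- The Chinese remainder map from ℤ/6 to ℤ/2 × ℤ/3, applied to `ζ`; both components are the same
  -- integer, read modulo 2 and modulo 3.
  ⟦_⟧ : Vector ℤ 3 → ℤ × ℤ
  ⟦ x ⟧ = ζ (φ x) , ζ (φ x)

  ζφ-+ : ∀ x y → ζ (φ (x ⊕ y)) ≡ ζ (φ x) ℤ.+ ζ (φ y)
  ζφ-+ x y = trans (ζ-cong (φ-+ x y))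
    (solve 4 (λ a b c d → (b :+ d) :- con (+ 2) :* (a :+ c) := (b :- con (+ 2) :* a) :+ (d :- con (+ 2) :* c))
      refl (φ x 0F) (φ x 1F) (φ y 0F) (φ y 1F))

  ζφ-neg : ∀ x → ζ (φ (λ i → ℤ.- x i)) ≡ ℤ.- ζ (φ x)
  ζφ-neg x = trans (ζ-cong (φ-neg x)) (ζ-neg (φ x))

  ζφ-− : ∀ x y → ζ (φ (x ⊖ y)) ≡ ζ (φ x) ℤ.- ζ (φ y)
  ζφ-− x y = trans (ζφ-+ x (λ i → ℤ.- y i)) (cong (ℤ._+_ (ζ (φ x))) (ζφ-neg y))

  ≈⇔ : ∀ {x y} → x Q.≈ y ⇔ (+ 6) Signed.∣ (ζ (φ x) ℤ.- ζ (φ y))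
  ≈⇔ {x} {y} = mk⇔
    (λ (_ , p) → subst (+ 6 Signed.∣_) (ζφ-− x y) (to (hermite-member (φ (x ⊖ y))) p))
    (λ d → tt , from (hermite-member (φ (x ⊖ y))) (subst (+ 6 Signed.∣_) (sym (ζφ-− x y)) d))

  ≡⇒≈ᴼ : ∀ {p q} → p ≡ q → p O.≈ q
  ≡⇒≈ᴼ {p} refl = O.refl {p}

  ⟦⟧-cong : ∀ {x y} → x Q.≈ y → ⟦ x ⟧ O.≈ ⟦ y ⟧
  ⟦⟧-cong {x} {y} p = halve (to (≈⇔ {x} {y}) p)
    where
    halve : (+ 6) Signed.∣ (ζ (φ x) ℤ.- ζ (φ y)) → ⟦ x ⟧ O.≈ ⟦ y ⟧
    halve d = ℕ.∣-trans (ℕ.divides 3 refl) (Signed.∣⇒∣ᵤ d) , ℕ.∣-trans (ℕ.divides 2 refl) (Signed.∣⇒∣ᵤ d)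

  -- From d = 2a = 3b follows d = 3d − 2d = 6(a − b).
  ⟦⟧-injective : ∀ {x y} → ⟦ x ⟧ O.≈ ⟦ y ⟧ → x Q.≈ y
  ⟦⟧-injective {x} {y} (2∣ , 3∣) = from (≈⇔ {x} {y}) (six (Signed.∣ᵤ⇒∣ 2∣) (Signed.∣ᵤ⇒∣ 3∣))
    where
    six : ∀ {d} → (+ 2) Signed.∣ d → (+ 3) Signed.∣ d → (+ 6) Signed.∣ d
    six {d} (Signed.divides a p) (Signed.divides b q) = Signed.divides (a ℤ.- b)
      (trans (solve 1 (λ d → d := con (+ 3) :* d :- con (+ 2) :* d) refl d)
        (trans (cong₂ (λ u v → + 3 ℤ.* u ℤ.- + 2 ℤ.* v) p q)
          (solve 2 (λ a b → con (+ 3) :* (a :* con (+ 2)) :- con (+ 2) :* (b :* con (+ 3)) := (a :- b) :* con (+ 6))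
            refl a b)))

  ⟦⟧-neg : ∀ x → ⟦ (λ i → ℤ.- x i) ⟧ ≡ (ℤ.- ζ (φ x) , ℤ.- ζ (φ x))
  ⟦⟧-neg x = cong (λ z → z , z) (ζφ-neg x)

  -- Under `ζ` the three generators become -2, -1 and 1, that is (0,1), -(1,1) and (1,1) in ℤ/2 ×
  -- ℤ/3; up to sign two of them coincide.
  cayIso : CayIso (FiniteQuotient.group (fold (splitting C) ⟨ hermiteBasis ⟩))
                  (Connection diamondPartition C (fold (splitting C) ⟨ hermiteBasis ⟩))
                  ℤ₂×ℤ₃ octahedronConnection
  cayIso = record
    { ⟦_⟧           = ⟦_⟧
    ; isIsomorphism = record
      { isGroupMonomorphism = record
        { isGroupHomomorphism = record
          { isMonoidHomomorphism = record
            { isMagmaHomomorphism = record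
              { isRelHomomorphism = record { cong = λ {x} {y} → ⟦⟧-cong {x} {y} }
              ; homo = λ x y → ≡⇒≈ᴼ (cong (λ z → z , z) (ζφ-+ x y))
              }
            ; ε-homo = O.refl {0ℤ , 0ℤ}
            }
          ; ⁻¹-homo = λ x → ≡⇒≈ᴼ (⟦⟧-neg x)
          }
        ; injective = λ {x} {y} → ⟦⟧-injective {x} {y}
        }
      ; surjective = λ (a , b) → preimage a b , λ {z} p →
          O.trans {⟦ z ⟧} {⟦ preimage a b ⟧} {a , b} (⟦⟧-cong {z} {preimage a b} p) (image a b)
      }
    ; connection⇔   = λ s → mk⇔ (λ (_ , j , eq) → forth s j eq) (λ (j , eq) → back s j eq)
    }
    where
    -- The coefficients 3 and -2 are the Chinese remainder idempotents: 3a - 2b is a modulo 2 and b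
    -- modulo 3.
    preimage : ℤ → ℤ → Vector ℤ 3
    preimage a b = section (pair 0ℤ (+ 3 ℤ.* a ℤ.- + 2 ℤ.* b))

    image : ∀ a b → ⟦ preimage a b ⟧ O.≈ (a , b)
    image a b =
      Signed.∣⇒∣ᵤ (Signed.divides (a ℤ.- b) (solve 2 (λ a b →
        (con 0ℤ :+ (con (+ 3) :* a :- con (+ 2) :* b)) :- con 0ℤ :- a := (a :- b) :* con (+ 2)) refl a b)) ,
      Signed.∣⇒∣ᵤ (Signed.divides (a ℤ.- b) (solve 2 (λ a b →
        (con 0ℤ :+ (con (+ 3) :* a :- con (+ 2) :* b)) :- con 0ℤ :- b := (a :- b) :* con (+ 3)) refl a b))

    generatorᴼ : Vector (ℤ × ℤ) 2
    generatorᴼ = pair (+ 0 , + 1) (+ 1 , + 1)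

    _≈ᴼ?_ : ∀ p q → Dec (p O.≈ q)
    p ≈ᴼ? q = (2 ℕ.∣? _) ×-dec (3 ℕ.∣? _)

    e -e : Fin 3 → Vector ℤ 3
    e     = unit diamondPartition
    -e j i = ℤ.- e j i

    connectionᴼ? : ∀ p → Dec (octahedronConnection p)
    connectionᴼ? p = Fin.any? λ j → (p ≈ᴼ? generatorᴼ j) ⊎-dec (p ≈ᴼ? (generatorᴼ j O.⁻¹))

    connectionᴼ-resp : ∀ {p q} → p O.≈ q → octahedronConnection q → octahedronConnection p
    connectionᴼ-resp {p} {q} p≈q (j , eq) = j , Sum.map
      (O.trans {p} {q} {generatorᴼ j} p≈q) (O.trans {p} {q} {generatorᴼ j O.⁻¹} p≈q) eq

    e-image : ∀ j → octahedronConnection ⟦ e j ⟧ × octahedronConnection ⟦ -e j ⟧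
    e-image = Dec.toWitness {a? = Fin.all? λ j → connectionᴼ? ⟦ e j ⟧ ×-dec connectionᴼ? ⟦ -e j ⟧} _

    e-preimage : ∀ j → ∃ λ i → ⟦ e i ⟧ O.≈ generatorᴼ j × ⟦ -e i ⟧ O.≈ (generatorᴼ j O.⁻¹)
    e-preimage = Dec.toWitness {a? = Fin.all? λ j → Fin.any? λ i →
      (⟦ e i ⟧ ≈ᴼ? generatorᴼ j) ×-dec (⟦ -e i ⟧ ≈ᴼ? (generatorᴼ j O.⁻¹))} _

    generatorᴼ≉ε : ∀ j → ¬ generatorᴼ j O.≈ O.ε × ¬ (generatorᴼ j O.⁻¹) O.≈ O.ε
    generatorᴼ≉ε = Dec.toWitness {a? = Fin.all? λ j →
      ¬? (generatorᴼ j ≈ᴼ? O.ε) ×-dec ¬? ((generatorᴼ j O.⁻¹) ≈ᴼ? O.ε)} _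

    forth : ∀ s j → s Q.≈ e j ⊎ s Q.≈ -e j → octahedronConnection ⟦ s ⟧
    forth s j (inj₁ eq) = connectionᴼ-resp {⟦ s ⟧} {⟦ e j ⟧} (⟦⟧-cong {s} {e j} eq) (proj₁ (e-image j))
    forth s j (inj₂ eq) = connectionᴼ-resp {⟦ s ⟧} {⟦ -e j ⟧} (⟦⟧-cong {s} { -e j } eq) (proj₂ (e-image j))

    nonzero : ∀ s {p} → ⟦ s ⟧ O.≈ p → ¬ p O.≈ O.ε → ¬ s Q.≈ Q.ε
    nonzero s {p} eq p≉ε s≈ε = p≉ε (O.trans {p} {⟦ s ⟧} {O.ε} (O.sym {⟦ s ⟧} {p} eq) (⟦⟧-cong {s} {Q.ε} s≈ε))

    back : ∀ s j → ⟦ s ⟧ O.≈ generatorᴼ j ⊎ ⟦ s ⟧ O.≈ (generatorᴼ j O.⁻¹) →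
           Connection diamondPartition C (fold (splitting C) ⟨ hermiteBasis ⟩) s
    back s j (inj₁ eq) = let i , p , _ = e-preimage j in
      nonzero s {generatorᴼ j} eq (proj₁ (generatorᴼ≉ε j)) , i , inj₁ (⟦⟧-injective {s} {e i}
        (O.trans {⟦ s ⟧} {generatorᴼ j} {⟦ e i ⟧} eq (O.sym {⟦ e i ⟧} {generatorᴼ j} p)))
    back s j (inj₂ eq) = let i , _ , p = e-preimage j in
      nonzero s {generatorᴼ j O.⁻¹} eq (proj₂ (generatorᴼ≉ε j)) , i , inj₂ (⟦⟧-injective {s} { -e i }
        (O.trans {⟦ s ⟧} {generatorᴼ j O.⁻¹} {⟦ -e i ⟧} eq (O.sym {⟦ -e i ⟧} {generatorᴼ j O.⁻¹} p)))

module _ (d : ℕ) .{{_ : ℕ.NonZero d}} where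

  residue : ℤ → Fin d
  residue z = Fin.fromℕ< (ℤ.n%ℕd<d z d)

  quotient-remainder : ∀ z → (+ d) Signed.∣ (z ℤ.- + toℕ (residue z))
  quotient-remainder z = Signed.divides (z ℤ./ℕ d) (trans
    (cong₂ (λ u r → u ℤ.- + r) (ℤ.a≡a%ℕn+[a/ℕn]*n z d) (Fin.toℕ-fromℕ< (ℤ.n%ℕd<d z d)))
    (solve 2 (λ r m → (r :+ m) :- r := m) refl (+ (z ℤ.%ℕ d)) (z ℤ./ℕ d ℤ.* + d)))

  residue-injective : ∀ {x y} → residue x ≡ residue y → (+ d) Signed.∣ (x ℤ.- y)
  residue-injective {x} {y} eq = subst (+ d Signed.∣_)
    (trans (cong (λ r → x ℤ.- + toℕ r ℤ.- (y ℤ.- + toℕ (residue y))) eq)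
           (solve 3 (λ x y r → x :- r :- (y :- r) := x :- y) refl x y (+ toℕ (residue y))))
    (Signed.∣m∣n⇒∣m-n (quotient-remainder x) (quotient-remainder y))

  toℕ-unique : ∀ {r s : Fin d} → (+ d) Signed.∣ (+ toℕ r ℤ.- + toℕ s) → r ≡ s
  toℕ-unique {r} {s} (Signed.divides k eq) = Fin.toℕ-injective (Residues.remainder-unique d (toℕ r) (toℕ s) k
    (Fin.toℕ<n r) (Fin.toℕ<n s)
    (trans (solve 2 (λ r s → r := s :+ (r :- s)) refl (+ toℕ r) (+ toℕ s)) (cong (ℤ._+_ (+ toℕ s)) eq)))

  residue-cong : ∀ {x y} → (+ d) Signed.∣ (x ℤ.- y) → residue x ≡ residue y
  residue-cong {x} {y} d∣ = toℕ-unique (subst (+ d Signed.∣_)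
    (solve 4 (λ x y r s → (x :- y) :- (x :- r) :+ (y :- s) := r :- s) refl x y (+ toℕ (residue x)) (+ toℕ (residue y)))
    (Signed.∣m∣n⇒∣m+n (Signed.∣m∣n⇒∣m-n d∣ (quotient-remainder x)) (quotient-remainder y)))

  residue-toℕ : ∀ (r : Fin d) → residue (+ toℕ r) ≡ r
  residue-toℕ r = Fin.toℕ-injective (trans (Fin.toℕ-fromℕ< _) (ℕ.m<n⇒m%n≡m (Fin.toℕ<n r)))

-- The connection set consists of all four elements with nonzero ℤ/3 component, so adjacency means
-- different ℤ/3 components, and these index the three parts.
octahedron-iso : GraphIso (Cay ℤ₂×ℤ₃ octahedronConnection) octahedron
octahedron-iso = record
  { bijection = record
    { to        = coordinates
    ; from      = λ (i , j) → + toℕ j , + toℕ i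
    ; to-cong   = λ {p} {q} → coordinates-cong {p} {q}
    ; from-cong = λ { {p} refl → O.refl {+ toℕ (proj₂ p) , + toℕ (proj₁ p)} }
    ; inverse   = (λ { {i , j} {q} eq → trans (coordinates-cong {q} {+ toℕ j , + toℕ i} eq)
                         (cong₂ _,_ (residue-toℕ 3 i) (residue-toℕ 2 j)) })
                , λ { {a , b} refl → Signed.∣⇒∣ᵤ (residue-injective 2 {+ toℕ (residue 2 a)} {a}
                                                      (residue-toℕ 2 (residue 2 a)))
                                   , Signed.∣⇒∣ᵤ (residue-injective 3 {+ toℕ (residue 3 b)} {b}
                                                      (residue-toℕ 3 (residue 3 b))) }
    }
  ; adj⇔ = λ p q → mk⇔ (forth p q) (back p q)
  }
  where
  coordinates : ℤ × ℤ → Fin 3 × Fin 2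
  coordinates (a , b) = residue 3 b , residue 2 a

  coordinates-cong : ∀ {p q} → p O.≈ q → coordinates p ≡ coordinates q
  coordinates-cong {a , b} {a′ , b′} (2∣ , 3∣) =
    cong₂ _,_ (residue-cong 3 {b} {b′} (Signed.∣ᵤ⇒∣ 3∣)) (residue-cong 2 {a} {a′} (Signed.∣ᵤ⇒∣ 2∣))

  open UGraph (Cay ℤ₂×ℤ₃ octahedronConnection) using (Adj)

  3∤ : ∀ {z} → (+ 3) Signed.∣ z → z ≢ + 1 × z ≢ -1ℤ
  3∤ 3∣z = (λ { refl → 3∤1 3∣z }) , λ { refl → 3∤1 (Signed.∣m⇒∣-m 3∣z) }
    where
    3∤1 : ¬ (+ 3) Signed.∣ (+ 1)
    3∤1 = Dec.toWitness {a? = ¬? (+ 3 Signed.∣? + 1)} _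

  forth : ∀ p q → Adj p q → residue 3 (proj₂ p) ≢ residue 3 (proj₂ q)
  forth (a , b) (a′ , b′) ((s , t) , conn , (_ , 3∣)) eq = by-third conn
    where
    3∣t : (+ 3) Signed.∣ t
    3∣t = subst (+ 3 Signed.∣_) (solve 3 (λ b b′ t → :- (b :- b′) :- (b′ :- (b :+ t)) := t) refl b b′ t)
      (Signed.∣m∣n⇒∣m-n (Signed.∣m⇒∣-m (residue-injective 3 {b} {b′} eq)) (Signed.∣ᵤ⇒∣ 3∣))
    near : ∀ {c} → (+ 3) ℤ.∣ (t ℤ.- c) → (+ 3) Signed.∣ c
    near {c} d = subst (+ 3 Signed.∣_) (solve 2 (λ t c → t :- (t :- c) := c) refl t c)
      (Signed.∣m∣n⇒∣m-n 3∣t (Signed.∣ᵤ⇒∣ d))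
    by-third : ¬ octahedronConnection (s , t)
    by-third (0F , inj₁ (_ , d)) = proj₁ (3∤ (near d)) refl
    by-third (0F , inj₂ (_ , d)) = proj₂ (3∤ (near d)) refl
    by-third (1F , inj₁ (_ , d)) = proj₁ (3∤ (near d)) refl
    by-third (1F , inj₂ (_ , d)) = proj₂ (3∤ (near d)) refl

  back : ∀ p q → residue 3 (proj₂ p) ≢ residue 3 (proj₂ q) → Adj p q
  back (a , b) (a′ , b′) differ = adjacent (residue 2 (a′ ℤ.- a)) (quotient-remainder 2 (a′ ℤ.- a))
                                           (residue 3 (b′ ℤ.- b)) (quotient-remainder 3 (b′ ℤ.- b))
    where
    moved : ∀ {d} x y c c′ → (+ d) Signed.∣ (c ℤ.- c′) → (+ d) Signed.∣ (y ℤ.- x ℤ.- c) →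
            (+ d) ℤ.∣ (y ℤ.- (x ℤ.+ c′))
    moved {d} x y c c′ p q = Signed.∣⇒∣ᵤ (subst (+ d Signed.∣_)
      (solve 4 (λ x y c c′ → (y :- x :- c) :+ (c :- c′) := y :- (x :+ c′)) refl x y c c′)
      (Signed.∣m∣n⇒∣m+n q p))
    0∣ : ∀ d → (+ d) Signed.∣ 0ℤ
    0∣ d = Signed.divides 0ℤ refl
    adjacent : (r : Fin 2) → (+ 2) Signed.∣ (a′ ℤ.- a ℤ.- + toℕ r) →
               (s : Fin 3) → (+ 3) Signed.∣ (b′ ℤ.- b ℤ.- + toℕ s) → Adj (a , b) (a′ , b′)
    adjacent r 2∣ 0F 3∣ = contradiction
      (sym (residue-cong 3 {b′} {b} (subst (+ 3 Signed.∣_) (ℤ.+-identityʳ (b′ ℤ.- b)) 3∣))) differ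
    adjacent 0F 2∣ 1F 3∣ = (+ 0 , + 1) , (0F , inj₁ (O.refl {+ 0 , + 1})) ,
      moved a a′ (+ 0) (+ 0) (0∣ 2) 2∣ , moved b b′ (+ 1) (+ 1) (0∣ 3) 3∣
    adjacent 1F 2∣ 1F 3∣ = (+ 1 , + 1) , (1F , inj₁ (O.refl {+ 1 , + 1})) ,
      moved a a′ (+ 1) (+ 1) (0∣ 2) 2∣ , moved b b′ (+ 1) (+ 1) (0∣ 3) 3∣
    -- Residue 2 modulo 3 is -1, so the step is an inverse generator; the required divisibility of 2
    -- - (-1) by 3 is reflexivity.
    adjacent 0F 2∣ 2F 3∣ = (+ 0 , -1ℤ) , (0F , inj₂ (O.refl {+ 0 , -1ℤ})) ,
      moved a a′ (+ 0) (+ 0) (0∣ 2) 2∣ , moved b b′ (+ 2) -1ℤ Signed.∣-refl 3∣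
    adjacent 1F 2∣ 2F 3∣ = (-1ℤ , -1ℤ) , (1F , inj₂ (O.refl { -1ℤ , -1ℤ })) ,
      moved a a′ (+ 1) -1ℤ Signed.∣-refl 2∣ , moved b b′ (+ 2) -1ℤ Signed.∣-refl 3∣

theorem8 :
  ( (G : Graph) → Graph.Connected G →
    (P : OrientedPartition G) (C : Choices G) {f : ℕ} (I : Splitting (Γuniv P C) f) →
      ( (R : FiniteQuotient (Γuniv P C)) →
          (Isometric P C R × KernelInFreePart I R)
          ⇔ (∃ λ (L : FiniteIndexSublattice f) → HasKernel I R L × Passes P C I L) )
    × ( (bound : ℕ) (H : HNFBasis f) → search P C I bound ≡ just H →
          Passes P C I ⟨ H ⟩
        × Isometric P C (fold I ⟨ H ⟩)
        × ( (R : FiniteQuotient (Γuniv P C)) → Isometric P C R → KernelInFreePart I R →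
              FiniteQuotient.order (fold I ⟨ H ⟩) ≤ FiniteQuotient.order R ) )
    × ( (R : FiniteQuotient (Γuniv P C)) → Isometric P C R → KernelInFreePart I R →
          ∃ λ (bound : ℕ) → ∃ λ (H : HNFBasis f) → search P C I bound ≡ just H ) )
  ×
  ( (C : Choices diamond) → Choices.root C ≡ zero →
    ∃ λ (I : Splitting (Γuniv diamondPartition C) 2) →
      ( (s : AbelianGroup.Carrier (Splitting.T I)) →
          AbelianGroup._≈_ (Splitting.T I) s (AbelianGroup.ε (Splitting.T I)) )
    × ( (j : Fin 3) → Splitting.free I (generator diamondPartition C j) ≗ diamondGenerators j )
    × ( (v : Fin 4) → Splitting.free I (label diamondPartition C v) ≗ diamondLabels v )
    × ( (L : FiniteIndexSublattice 2) → IsDiagonal L → FiniteIndexSublattice.index L ≡ 6 →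
          ¬ Passes diamondPartition C I L )
    × ( ∃ λ (L : FiniteIndexSublattice 2) →
          (FiniteIndexSublattice.lattice L ≐ rowLattice optimalBasis)
        × ¬ IsDiagonal L
        × FiniteIndexSublattice.index L ≡ 6
        × Passes diamondPartition C I L
        × Isometric diamondPartition C (fold I L)
        × FiniteQuotient.order (fold I L) ≡ 6
        × CayIso (FiniteQuotient.group (fold I L)) (Connection diamondPartition C (fold I L))
                 ℤ₂×ℤ₃ octahedronConnection
        × GraphIso (Cay ℤ₂×ℤ₃ octahedronConnection) octahedron )
    × ( (R : FiniteQuotient (Γuniv diamondPartition C)) → Isometric diamondPartition C R →
          6 ≤ FiniteQuotient.order R ) )
theorem8 =
    (λ G connected P C {f} I →
        Enumeration.sublattice-quotients {G} connected P C {f} I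
      , (λ bound H found →
          Enumeration.search-passes {G} connected P C {f} I bound H found
        , Hosts.Search.exact⇒isometric P C (fold I ⟨ H ⟩) connected
            (Enumeration.search-passes {G} connected P C {f} I bound H found)
        , λ R iso intact → Enumeration.search-minimal {G} connected P C {f} I R iso intact bound H found)
      , Enumeration.search-finds {G} connected P C {f} I)
  , λ C root≡0 →
        splitting C
      , (λ _ → tt)
      , φ-unit
      , φ-label C root≡0
      , (λ L diagonal index≡6 passes →
          diagonal-fails L diagonal index≡6 (to (passes⇔avoids C root≡0 L) passes))
      , ( ⟨ hermiteBasis ⟩
        , hermite≐optimal
        , hermite-not-diagonal
        , refl
        , from (passes⇔avoids C root≡0 ⟨ hermiteBasis ⟩) hermite-avoids
        , from (isometric⇔avoids C root≡0 ⟨ hermiteBasis ⟩) hermite-avoids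
        , refl
        , cayIso C
        , octahedron-iso )
      , 6≤order C root≡0
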